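{- There exists an absolute constant $C>0$ such that for all integers $\Delta\ge 2$ and $\omega\ge 2$, every graph $G$ of maximum degree at most $\Delta$ with no clique of size greater than $\omega$ satisfies \[ \chi_\ell(G)\le C\,\Delta\sqrt{\frac{\ln(\omega)}{\ln(\Delta)}}. \]
   Context: $\chi_\ell(G)$ denotes the list-chromatic number (choice number) of $G$: the least $k$ such that $G$ has a proper coloring from the lists $L(v)$ for every assignment of lists $L$ with $|L(v)|\ge k$ for all $v$. -}

module Defs where

open import Data.Nat using (ℕ; _≤_; _≥_)
open import Data.Bool using (Bool; true; false; T)
open import Data.Bool.Properties using (T?)
open import Data.Fin using (Fin)
open import Data.List using (List; length; filter)
open import Data.List.Base using ()
open import Data.List.Membership.Propositional using (_∈_)
open import Data.List.Relation.Unary.Unique.Propositional using (Unique)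
open import Data.Product using (Σ; _×_)
open import Function.Definitions using (Injective)
open import Relation.Binary.PropositionalEquality using (_≡_; _≢_)

open import Data.List using (allFin) public

record Graph (n : ℕ) : Set where
  field
    adj   : Fin n → Fin n → Bool
    sym   : ∀ u v → adj u v ≡ adj v u
    loopless : ∀ v → adj v v ≡ false
open Graph public

degree : ∀ {n} → Graph n → Fin n → ℕ
degree G v = length (filter (λ u → T? (adj G v u)) (allFin _))

MaxDegree≤ : ∀ {n} → Graph n → ℕ → Set
MaxDegree≤ G Δ = ∀ v → degree G v ≤ Δ

IsClique : ∀ {n m} → Graph n → (Fin m → Fin n) → Set
IsClique G f = Injective _≡_ _≡_ f × (∀ i j → i ≢ j → T (adj G (f i) (f j)))

CliqueNumber≤ : ∀ {n} → Graph n → ℕ → Set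
CliqueNumber≤ G ω = ∀ m (f : Fin m → Fin _) → IsClique G f → m ≤ ω

ListAssignment : ℕ → ℕ → Set
ListAssignment n k = Σ (Fin n → List ℕ) λ L → ∀ v → Unique (L v) × length (L v) ≥ k

ProperListColouring : ∀ {n} → Graph n → (Fin n → List ℕ) → (Fin n → ℕ) → Set
ProperListColouring G L c =
  (∀ v → c v ∈ L v) × (∀ u v → T (adj G u v) → c u ≢ c v)

-- G is k-choosable, i.e. χ_ℓ(G) ≤ k (χ_ℓ is the least such k, and choosability is monotone).
Choosable : ∀ {n} → Graph n → ℕ → Set
Choosable {n} G k = (LA : ListAssignment n k) →
  Σ (Fin n → ℕ) λ c → ProperListColouring G (Data.Product.proj₁ LA) c

{-# OPTIONS --safe #-}

-- Count proper list colourings of induced subgraphs, deleting vertices one at a time (Rosenfeld's method): a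
-- uniformly random colouring of U ∖ {v} leaves on average at least 2 θ m of the k ≈ 2 Δ / m colours of L v free,
-- so adding v multiplies the number of colourings by that factor. For a colour x, the set of neighbours of v
-- coloured x (among those with a second choice) is distributed as a mixture of uniformly random independent sets
-- in subgraphs of G. In a graph without large cliques such an independent set is either empty with probability
-- at least 1 / θ or has average size at least m, where θ is ω to the power O(m²). As the average sizes add up to
-- at most Δ over all x, many colours are missing around v. By induction few neighbours lack a second choice.
-- All this works when ω to the power O(m²) is at most Δ, i.e. for m of order √(ln Δ / ln ω).

module Submission where

open import Defs renaming (sym to adj-sym)
open import Data.Bool as Bool using (Bool; true; false; T; if_then_else_)
open import Data.Bool.Properties using (T?)
open import Data.Empty using (⊥-elim)
open import Data.Fin as Fin using (Fin; zero; suc)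
open import Data.Fin.Properties using (all?; any?; ¬∀⟶∃¬)
open import Data.List using (List; []; _∷_; _++_; map; filter; length; tabulate; take)
open import Data.List.Membership.Propositional using (_∈_; _∉_)
open import Data.List.Membership.Propositional.Properties using (∈-allFin; ∈-filter⁻; ∈-map⁻; ∈-++⁺ˡ)
open import Data.List.Properties using (filter-≐; length-map; length-take; take++drop≡id)
open import Data.List.Relation.Unary.All as All using ()
open import Data.List.Relation.Unary.AllPairs using ([]; _∷_)
open import Data.List.Relation.Unary.Any using (here; there)
open import Data.List.Relation.Unary.Unique.Propositional using (Unique)
open import Data.List.Relation.Unary.Unique.Propositional.Properties using (allFin⁺; map⁺; take⁺)
open import Data.Nat
open import Data.Nat.DivMod using (m/n*n≤m; m*n/n≡m; /-monoˡ-≤; m≡m%n+[m/n]*n; m%n<n)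
open import Data.Nat.Properties
open import Data.Nat.Tactic.RingSolver using (solve-∀)
open import Data.Product using (Σ; ∃; _×_; _,_; proj₁; proj₂)
open import Data.Product.Properties using () renaming (≡-dec to ×-≡-dec)
open import Data.Sum using (_⊎_; inj₁; inj₂)
open import Data.Unit using (⊤)
open import Data.Vec as Vec using (Vec; []; _∷_; lookup; _[_]≔_)
open import Data.Vec.Properties
  using (lookup∘update; lookup∘update′; []≔-idempotent; []≔-lookup; lookup-replicate; lookup∘tabulate)
  renaming (≡-dec to Vec-≡-dec)
open import Function using (_∘_; id; case_of_)
open import Relation.Binary using (DecidableEquality)
open import Relation.Binary.PropositionalEquality
  using (_≡_; _≢_; refl; sym; trans; cong; cong₂; subst; module ≡-Reasoning)
open import Relation.Nullary using (Dec; yes; no; ¬_; does; contradiction)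
open import Relation.Nullary.Decidable using (_×-dec_; _→-dec_; ¬?; decidable-stable; dec-true; dec-false)

open import Data.List.Membership.DecPropositional _≟_ using (_∈?_)

-- The obstacle is that recolouring one neighbour of v can change the options of others. The way out
-- is that vertices of one colour are never adjacent: all neighbours coloured x that have another
-- free colour move at once to a canonical alternative, and what each of them sees stays the same.
-- Recording the moved set makes this an exact bijection, and every independent set of candidate
-- vertices occurs as such a record. A neighbour with a single free colour cannot move. Its colour
-- is a function of the rest, so the colourings in which this happens inject into those with that
-- vertex deleted, and the growth factor being proved bounds their share. The induction thus feeds
-- its own factor back in, and the condition 8 θ² m ≤ k closes this loop. No probabilities occur: an
-- average is a sum over all colourings, and every inequality is cleared of denominators. The final
-- one compares powers in place of logarithms and a square root.

private variable
  A B : Set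
  P Q R : Set

-- Finite sums and indicators

∑ : List A → (A → ℕ) → ℕ
∑ []       f = 0
∑ (x ∷ xs) f = f x + ∑ xs f

syntax ∑ xs (λ x → e) = ∑[ x ∈ xs ] e

𝟙 : Dec P → ℕ
𝟙 p = if does p then 1 else 0

𝟙-yes : (p : Dec P) → P → 𝟙 p ≡ 1
𝟙-yes p h rewrite dec-true p h = refl

𝟙-no : (p : Dec P) → ¬ P → 𝟙 p ≡ 0
𝟙-no p h rewrite dec-false p h = refl

𝟙-mono : (p : Dec P) (q : Dec Q) → (P → Q) → 𝟙 p ≤ 𝟙 q
𝟙-mono (yes h) q f = ≤-reflexive (sym (𝟙-yes q (f h)))
𝟙-mono (no _)  q f = z≤n

𝟙-cong : (p : Dec P) (q : Dec Q) → (P → Q) → (Q → P) → 𝟙 p ≡ 𝟙 q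
𝟙-cong p q f g = ≤-antisym (𝟙-mono p q f) (𝟙-mono q p g)

𝟙-× : (p : Dec P) (q : Dec Q) → 𝟙 (p ×-dec q) ≡ 𝟙 p * 𝟙 q
𝟙-× (yes _) (yes _) = refl
𝟙-× (yes _) (no _)  = refl
𝟙-× (no _)  q       = refl

𝟙≤1 : (p : Dec P) → 𝟙 p ≤ 1
𝟙≤1 (yes _) = ≤-refl
𝟙≤1 (no _)  = z≤n

𝟙≤ : (p : Dec P) {a : ℕ} → (P → 1 ≤ a) → 𝟙 p ≤ a
𝟙≤ (yes h) f = f h
𝟙≤ (no _)  f = z≤n

1≤𝟙+ : (p : Dec P) {a : ℕ} → (¬ P → 1 ≤ a) → 1 ≤ 𝟙 p + a
1≤𝟙+ (yes _) f = s≤s z≤n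
1≤𝟙+ (no ¬h) f = f ¬h

𝟙-*-cong : (p : Dec P) {a b : ℕ} → (P → a ≡ b) → 𝟙 p * a ≡ 𝟙 p * b
𝟙-*-cong (yes h) f = cong (1 *_) (f h)
𝟙-*-cong (no _)  f = refl

𝟙-*-mono : (p : Dec P) {a b : ℕ} → (P → a ≤ b) → 𝟙 p * a ≤ 𝟙 p * b
𝟙-*-mono (yes h) f = *-monoʳ-≤ 1 (f h)
𝟙-*-mono (no _)  f = z≤n

𝟙-disjoint : (p : Dec P) (q : Dec Q) (r : Dec R) → (P → R) → (Q → R) → (P → ¬ Q) → 𝟙 p + 𝟙 q ≤ 𝟙 r
𝟙-disjoint (yes x) (yes y) r f g h = contradiction y (h x)
𝟙-disjoint (yes x) (no _)  r f g h = ≤-reflexive (sym (𝟙-yes r (f x)))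
𝟙-disjoint (no _)  q       r f g h = 𝟙-mono q r g

𝟙-cover : (p : Dec P) (q : Dec Q) (r : Dec R) → (P → ¬ Q → R) → 𝟙 p ≤ 𝟙 q + 𝟙 r
𝟙-cover (no _)  q       r f = z≤n
𝟙-cover (yes x) (yes y) r f = s≤s z≤n
𝟙-cover (yes x) (no ¬y) r f = ≤-reflexive (sym (𝟙-yes r (f x ¬y)))

∑-cong-∈ : (xs : List A) {f g : A → ℕ} → (∀ x → x ∈ xs → f x ≡ g x) → ∑ xs f ≡ ∑ xs g
∑-cong-∈ []       h = refl
∑-cong-∈ (x ∷ xs) h = cong₂ _+_ (h x (here refl)) (∑-cong-∈ xs (λ y → h y ∘ there))

∑-cong : (xs : List A) {f g : A → ℕ} → (∀ x → f x ≡ g x) → ∑ xs f ≡ ∑ xs g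
∑-cong xs h = ∑-cong-∈ xs (λ x _ → h x)

∑-mono-∈ : (xs : List A) {f g : A → ℕ} → (∀ x → x ∈ xs → f x ≤ g x) → ∑ xs f ≤ ∑ xs g
∑-mono-∈ []       h = z≤n
∑-mono-∈ (x ∷ xs) h = +-mono-≤ (h x (here refl)) (∑-mono-∈ xs (λ y → h y ∘ there))

∑-mono : (xs : List A) {f g : A → ℕ} → (∀ x → f x ≤ g x) → ∑ xs f ≤ ∑ xs g
∑-mono xs h = ∑-mono-∈ xs (λ x _ → h x)

∑-zero : (xs : List A) → ∑ xs (λ _ → 0) ≡ 0
∑-zero []       = refl
∑-zero (x ∷ xs) = ∑-zero xs

∑-const : (xs : List A) (a : ℕ) → ∑ xs (λ _ → a) ≡ length xs * a
∑-const []       a = refl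
∑-const (x ∷ xs) a = cong (a +_) (∑-const xs a)

∑-+ : (xs : List A) (f g : A → ℕ) → ∑[ x ∈ xs ] (f x + g x) ≡ ∑ xs f + ∑ xs g
∑-+ []       f g = refl
∑-+ (x ∷ xs) f g rewrite ∑-+ xs f g = interchange (f x) (g x) (∑ xs f) (∑ xs g)
  where
  interchange : ∀ a b c d → a + b + (c + d) ≡ a + c + (b + d)
  interchange = solve-∀

∑-*ˡ : (xs : List A) (a : ℕ) (f : A → ℕ) → ∑[ x ∈ xs ] (a * f x) ≡ a * ∑ xs f
∑-*ˡ []       a f = sym (*-zeroʳ a)
∑-*ˡ (x ∷ xs) a f = trans (cong (a * f x +_) (∑-*ˡ xs a f)) (sym (*-distribˡ-+ a (f x) (∑ xs f)))

∑-*ʳ : (xs : List A) (a : ℕ) (f : A → ℕ) → ∑[ x ∈ xs ] (f x * a) ≡ ∑ xs f * a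
∑-*ʳ []       a f = refl
∑-*ʳ (x ∷ xs) a f = trans (cong (f x * a +_) (∑-*ʳ xs a f)) (sym (*-distribʳ-+ a (f x) (∑ xs f)))

∑-swap : (xs : List A) (ys : List B) (f : A → B → ℕ) →
         ∑[ x ∈ xs ] ∑[ y ∈ ys ] f x y ≡ ∑[ y ∈ ys ] ∑[ x ∈ xs ] f x y
∑-swap []       ys f = sym (∑-zero ys)
∑-swap (x ∷ xs) ys f = trans (cong (∑ ys (f x) +_) (∑-swap xs ys f)) (sym (∑-+ ys (f x) _))

∑-++ : (xs ys : List A) (f : A → ℕ) → ∑ (xs ++ ys) f ≡ ∑ xs f + ∑ ys f
∑-++ []       ys f = refl
∑-++ (x ∷ xs) ys f = trans (cong (f x +_) (∑-++ xs ys f)) (sym (+-assoc (f x) _ _))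

∑-map : (xs : List A) (g : A → B) (f : B → ℕ) → ∑ (map g xs) f ≡ ∑[ x ∈ xs ] f (g x)
∑-map []       g f = refl
∑-map (x ∷ xs) g f = cong (f (g x) +_) (∑-map xs g f)

∑-positive : (xs : List A) {p : A → Set} (p? : ∀ x → Dec (p x)) → 0 < ∑[ x ∈ xs ] 𝟙 (p? x) → ∃ p
∑-positive (x ∷ xs) p? h with p? x
... | yes px = x , px
... | no _   = ∑-positive xs p? h

∑-∈ : (xs : List A) (f : A → ℕ) {x : A} → x ∈ xs → f x ≤ ∑ xs f
∑-∈ (x ∷ xs) f (here refl) = m≤m+n _ _
∑-∈ (x ∷ xs) f (there i)   = ≤-trans (∑-∈ xs f i) (m≤n+m _ _)

length-filter-∑ : {p : A → Set} (p? : ∀ x → Dec (p x)) (xs : List A) →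
                  length (filter p? xs) ≡ ∑[ x ∈ xs ] 𝟙 (p? x)
length-filter-∑ p? []       = refl
length-filter-∑ p? (x ∷ xs) with p? x
... | yes _ = cong suc (length-filter-∑ p? xs)
... | no _  = length-filter-∑ p? xs

-- Multiplicities in lists and double counting

module Multiplicity (_≟ᴬ_ : DecidableEquality A) where

  -- That an object is enumerated exactly once is expressed by multiplicity 1, because for products
  -- this reduces to a product of two sums and needs no uniqueness proof for lists of pairs or
  -- vectors.
  mult : A → List A → ℕ
  mult a xs = ∑[ x ∈ xs ] 𝟙 (x ≟ᴬ a)

  mult-∉ : ∀ {a} xs → a ∉ xs → mult a xs ≡ 0
  mult-∉ []       h = refl
  mult-∉ {a} (x ∷ xs) h = cong₂ _+_ (𝟙-no (x ≟ᴬ a) (λ { refl → h (here refl) })) (mult-∉ xs (h ∘ there))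

  mult-∈ : ∀ {a xs} → Unique xs → a ∈ xs → mult a xs ≡ 1
  mult-∈ {a} {x ∷ xs} (x∉ ∷ u) (here refl) =
    cong₂ _+_ (𝟙-yes (x ≟ᴬ x) refl) (mult-∉ xs (λ i → All.lookup x∉ i refl))
  mult-∈ {a} {x ∷ xs} (x∉ ∷ u) (there i) =
    cong₂ _+_ (𝟙-no (x ≟ᴬ a) (λ { refl → All.lookup x∉ i refl })) (mult-∈ u i)

  mult≤1 : ∀ {a xs} → Unique xs → mult a xs ≤ 1
  mult≤1 {a} {[]}     []       = z≤n
  mult≤1 {a} {x ∷ xs} (x∉ ∷ u) with x ≟ᴬ a
  ... | yes refl = ≤-reflexive (cong suc (mult-∉ xs (λ i → All.lookup x∉ i refl)))
  ... | no _     = mult≤1 u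

-- Double counting of the pairs (x , f x) = (g y , y).
∑-bijection :
  (_≟ᴬ_ : DecidableEquality A) (_≟ᴮ_ : DecidableEquality B)
  (xs : List A) (ys : List B) {p : A → Set} {q : B → Set}
  (p? : ∀ x → Dec (p x)) (q? : ∀ y → Dec (q y))
  (f : A → B) (g : B → A) (φ : A → ℕ) (ψ : B → ℕ) →
  (∀ x → p x → q (f x) × g (f x) ≡ x × φ x ≡ ψ (f x)) →
  (∀ y → q y → p (g y) × f (g y) ≡ y) →
  (∀ x → p x → Multiplicity.mult _≟ᴬ_ x xs ≡ 1) →
  (∀ y → q y → Multiplicity.mult _≟ᴮ_ y ys ≡ 1) →
  ∑[ x ∈ xs ] (𝟙 (p? x) * φ x) ≡ ∑[ y ∈ ys ] (𝟙 (q? y) * ψ y)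
∑-bijection _≟ᴬ_ _≟ᴮ_ xs ys p? q? f g φ ψ to from onceˣ onceʸ = begin
  ∑[ x ∈ xs ] (𝟙 (p? x) * φ x)
    ≡⟨ ∑-cong xs (λ x → trans (𝟙-*-cong (p? x) (λ px →
         trans (sym (*-identityʳ (φ x))) (cong (φ x *_) (sym (onceʸ (f x) (proj₁ (to x px)))))))
         (sym (trans (∑-*ˡ ys (𝟙 (p? x)) _) (cong (𝟙 (p? x) *_) (∑-*ˡ ys (φ x) _))))) ⟩
  ∑[ x ∈ xs ] ∑[ y ∈ ys ] (𝟙 (p? x) * (φ x * 𝟙 (y ≟ᴮ f x)))
    ≡⟨ ∑-cong xs (λ x → ∑-cong ys (λ y → pointwise x y)) ⟩
  ∑[ x ∈ xs ] ∑[ y ∈ ys ] (𝟙 (q? y) * (ψ y * 𝟙 (x ≟ᴬ g y)))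
    ≡⟨ ∑-swap xs ys _ ⟩
  ∑[ y ∈ ys ] ∑[ x ∈ xs ] (𝟙 (q? y) * (ψ y * 𝟙 (x ≟ᴬ g y)))
    ≡⟨ ∑-cong ys (λ y → trans (trans (∑-*ˡ xs (𝟙 (q? y)) _) (cong (𝟙 (q? y) *_) (∑-*ˡ xs (ψ y) _)))
         (𝟙-*-cong (q? y) (λ qy →
         trans (cong (ψ y *_) (onceˣ (g y) (proj₁ (from y qy)))) (*-identityʳ (ψ y))))) ⟩
  ∑[ y ∈ ys ] (𝟙 (q? y) * ψ y) ∎
  where
  open ≡-Reasoning
  pointwise : ∀ x y → 𝟙 (p? x) * (φ x * 𝟙 (y ≟ᴮ f x)) ≡ 𝟙 (q? y) * (ψ y * 𝟙 (x ≟ᴬ g y))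
  pointwise x y with p? x | q? y | y ≟ᴮ f x | x ≟ᴬ g y
  ... | yes px | yes qy | yes refl | yes _ = cong (λ a → 1 * (a * 1)) (proj₂ (proj₂ (to x px)))
  ... | yes px | yes qy | no ≢ | yes refl = contradiction (sym (proj₂ (from y qy))) ≢
  ... | yes px | yes qy | yes refl | no ≢ = contradiction (sym (proj₁ (proj₂ (to x px)))) ≢
  ... | yes px | yes qy | no _ | no _ = cong (1 *_) (trans (*-zeroʳ (φ x)) (sym (*-zeroʳ (ψ y))))
  ... | yes px | no ¬qy | yes refl | _ = contradiction (proj₁ (to x px)) ¬qy
  ... | yes px | no ¬qy | no _ | _ = cong (1 *_) (*-zeroʳ (φ x))
  ... | no ¬px | yes qy | _ | yes refl = contradiction (proj₁ (from y qy)) ¬px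
  ... | no ¬px | yes qy | _ | no _ = sym (cong (1 *_) (*-zeroʳ (ψ y)))
  ... | no _ | no _ | _ | _ = refl

-- Enumeration of pairs and vectors

pairs : List A → List B → List (A × B)
pairs []       ys = []
pairs (x ∷ xs) ys = map (x ,_) ys ++ pairs xs ys

∑-pairs : (xs : List A) (ys : List B) (f : A × B → ℕ) →
          ∑ (pairs xs ys) f ≡ ∑[ x ∈ xs ] ∑[ y ∈ ys ] f (x , y)
∑-pairs []       ys f = refl
∑-pairs (x ∷ xs) ys f =
  trans (∑-++ (map (x ,_) ys) _ f) (cong₂ _+_ (∑-map ys (x ,_) f) (∑-pairs xs ys f))

∑-product : (xs : List A) (ys : List B) (f : A → ℕ) (g : B → ℕ) →
            ∑[ x ∈ xs ] ∑[ y ∈ ys ] (f x * g y) ≡ ∑ xs f * ∑ ys g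
∑-product xs ys f g = trans (∑-cong xs (λ x → ∑-*ˡ ys (f x) g)) (∑-*ʳ xs (∑ ys g) f)

vecs : ∀ {n} → (Fin n → List A) → List (Vec A n)
vecs {n = zero}  L = [] ∷ []
vecs {n = suc n} L = map (λ { (a , v) → a ∷ v }) (pairs (L zero) (vecs (L ∘ suc)))

∑-vecs : ∀ {n} (L : Fin (suc n) → List A) (f : Vec A (suc n) → ℕ) →
         ∑ (vecs L) f ≡ ∑[ a ∈ L zero ] ∑[ v ∈ vecs (L ∘ suc) ] f (a ∷ v)
∑-vecs L f = trans (∑-map (pairs (L zero) (vecs (L ∘ suc))) _ f) (∑-pairs (L zero) (vecs (L ∘ suc)) _)

module _ (_≟ᴬ_ : DecidableEquality A) where
  open Multiplicity

  mult-pairs : (_≟ᴮ_ : DecidableEquality B) (a : A) (b : B) (xs : List A) (ys : List B) →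
               mult _≟ᴬ_ a xs ≡ 1 → mult _≟ᴮ_ b ys ≡ 1 →
               mult (×-≡-dec _≟ᴬ_ _≟ᴮ_) (a , b) (pairs xs ys) ≡ 1
  mult-pairs _≟ᴮ_ a b xs ys h k = trans (∑-pairs xs ys _) (trans
    (∑-cong xs (λ x → ∑-cong ys (λ y → trans
       (𝟙-cong (×-≡-dec _≟ᴬ_ _≟ᴮ_ (x , y) (a , b)) ((x ≟ᴬ a) ×-dec (y ≟ᴮ b))
               (λ { refl → refl , refl }) (λ { (refl , refl) → refl }))
       (𝟙-× (x ≟ᴬ a) (y ≟ᴮ b)))))
    (trans (∑-product xs ys _ _) (cong₂ _*_ h k)))

  mult-vecs : ∀ {n} (L : Fin n → List A) (v : Vec A n) → (∀ i → mult _≟ᴬ_ (lookup v i) (L i) ≡ 1) →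
              mult (Vec-≡-dec _≟ᴬ_) v (vecs L) ≡ 1
  mult-vecs {n = zero}  L []      h = refl
  mult-vecs {n = suc n} L (a ∷ v) h = trans (∑-vecs L _) (trans
    (∑-cong (L zero) (λ b → ∑-cong (vecs (L ∘ suc)) (λ w → trans
       (𝟙-cong (Vec-≡-dec _≟ᴬ_ (b ∷ w) (a ∷ v)) ((b ≟ᴬ a) ×-dec Vec-≡-dec _≟ᴬ_ w v)
               (λ { refl → refl , refl }) (λ { (refl , refl) → refl }))
       (𝟙-× (b ≟ᴬ a) (Vec-≡-dec _≟ᴬ_ w v)))))
    (trans (∑-product (L zero) (vecs (L ∘ suc)) _ _)
           (cong₂ _*_ (h zero) (mult-vecs (L ∘ suc) v (h ∘ suc)))))

lookup-injective : ∀ {n} {v w : Vec A n} → (∀ i → lookup v i ≡ lookup w i) → v ≡ w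
lookup-injective {v = []}    {[]}    h = refl
lookup-injective {v = _ ∷ _} {_ ∷ _} h = cong₂ _∷_ (h zero) (lookup-injective (h ∘ suc))

∑-tabulate : ∀ {n} (g : Fin n → A) (f : A → ℕ) → ∑ (tabulate g) f ≡ ∑[ i ∈ allFin n ] f (g i)
∑-tabulate {n = zero}  g f = refl
∑-tabulate {n = suc n} g f =
  cong (f (g zero) +_) (trans (∑-tabulate (g ∘ suc) f) (sym (∑-tabulate suc (f ∘ g))))

∑-allFin-suc : ∀ {n} (f : Fin (suc n) → ℕ) → ∑ (allFin (suc n)) f ≡ f zero + ∑[ i ∈ allFin n ] f (suc i)
∑-allFin-suc f = cong (f zero +_) (∑-tabulate suc f)

-- Cardinalities of vertex sets and small subsets

card : ∀ {n} {X : Fin n → Set} → (∀ u → Dec (X u)) → ℕ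
card {n = n} X? = ∑[ u ∈ allFin n ] 𝟙 (X? u)

card-mono : ∀ {n} {X Y : Fin n → Set} (X? : ∀ u → Dec (X u)) (Y? : ∀ u → Dec (Y u)) → (∀ u → X u → Y u) → card X? ≤ card Y?
card-mono X? Y? h = ∑-mono (allFin _) (λ u → 𝟙-mono (X? u) (Y? u) (h u))

module _ {n : ℕ} where
  open Multiplicity (Fin._≟_ {n})

  mult-allFin : ∀ u → mult u (allFin n) ≡ 1
  mult-allFin u = mult-∈ (allFin⁺ n) (∈-allFin u)

  _∖?_ : {X : Fin n → Set} → (∀ u → Dec (X u)) → ∀ v u → Dec (X u × u ≢ v)
  (X? ∖? v) u = X? u ×-dec ¬? (u Fin.≟ v)

  card-∖ : {X : Fin n → Set} (X? : ∀ u → Dec (X u)) (v : Fin n) → card X? ≤ suc (card (X? ∖? v))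
  card-∖ X? v = begin
    card X?
      ≤⟨ ∑-mono (allFin n) pointwise ⟩
    ∑[ u ∈ allFin n ] (𝟙 (u Fin.≟ v) + 𝟙 ((X? ∖? v) u))
      ≡⟨ ∑-+ (allFin n) _ _ ⟩
    mult v (allFin n) + card (X? ∖? v)
      ≡⟨ cong (_+ card (X? ∖? v)) (mult-allFin v) ⟩
    suc (card (X? ∖? v)) ∎
    where
    open ≤-Reasoning
    pointwise : ∀ u → 𝟙 (X? u) ≤ 𝟙 (u Fin.≟ v) + 𝟙 ((X? ∖? v) u)
    pointwise u with X? u | u Fin.≟ v
    ... | yes _ | yes _ = s≤s z≤n
    ... | yes _ | no _  = ≤-refl
    ... | no _  | _     = z≤n

  card-∖-< : {X : Fin n → Set} (X? : ∀ u → Dec (X u)) {v : Fin n} → X v → card (X? ∖? v) < card X?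
  card-∖-< X? {v} v∈X = begin
    suc (card (X? ∖? v))
      ≡⟨ cong (_+ card (X? ∖? v)) (sym (mult-allFin v)) ⟩
    mult v (allFin n) + card (X? ∖? v)
      ≡⟨ sym (∑-+ (allFin n) _ _) ⟩
    ∑[ u ∈ allFin n ] (𝟙 (u Fin.≟ v) + 𝟙 ((X? ∖? v) u))
      ≤⟨ ∑-mono (allFin n) (λ u → 𝟙-disjoint (u Fin.≟ v) ((X? ∖? v) u) (X? u)
           (λ { refl → v∈X }) proj₁ (λ u≡v u∈ → proj₂ u∈ u≡v)) ⟩
    card X? ∎
    where open ≤-Reasoning

  size : Vec Bool n → ℕ
  size S = card (λ u → T? (lookup S u))

subsets : ∀ n → List (Vec Bool n)
subsets n = vecs (λ _ → true ∷ false ∷ [])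

Within : ∀ {n} → (Fin n → Set) → Vec Bool n → Set
Within X S = ∀ u → T (lookup S u) → X u

within? : ∀ {n} {X : Fin n → Set} → (∀ u → Dec (X u)) → ∀ S → Dec (Within X S)
within? X? S = all? (λ u → T? (lookup S u) →-dec X? u)

small? : ∀ {n} {X : Fin n → Set} → (∀ u → Dec (X u)) → ∀ s (S : Vec Bool n) → Dec (Within X S × size S ≤ s)
small? X? s S = within? X? S ×-dec (size S ≤? s)

-- A set with at most s elements is the range of s choices, each an element of X or nothing. In the
-- induction, a set that contains the first vertex has one element less to spend on the rest, and
-- with a further elements this is (a+1)^r + (a+1)^(r+1) = (a+2)(a+1)^r ≤ (a+2)^(r+1).
count-small : ∀ {n} {X : Fin n → Set} (X? : ∀ u → Dec (X u)) s →
              ∑[ S ∈ subsets n ] 𝟙 (small? X? s S) ≤ suc (card X?) ^ s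
count-small {zero} X? s = begin
  𝟙 (small? X? s []) + 0 ≡⟨ +-identityʳ _ ⟩
  𝟙 (small? X? s [])     ≤⟨ 𝟙≤1 (small? X? s []) ⟩
  1                      ≤⟨ m^n>0 (suc (card X?)) s ⟩
  suc (card X?) ^ s      ∎
  where open ≤-Reasoning
count-small {suc n} {X} X? s = begin
  ∑[ S ∈ subsets (suc n) ] 𝟙 (small? X? s S)
    ≡⟨ ∑-vecs {n = n} (λ _ → true ∷ false ∷ []) (λ S → 𝟙 (small? X? s S)) ⟩
  with₀ + (without₀ + 0)
    ≡⟨ cong (with₀ +_) (+-identityʳ _) ⟩
  with₀ + without₀
    ≤⟨ +-monoʳ-≤ with₀ (≤-trans
         (∑-mono (subsets n) (λ S → 𝟙-mono (small? X? s (false ∷ S)) (small? X′? s S)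
           (λ { (w , k) → (λ u → w (suc u)) , subst (_≤ s) (∑-allFin-suc (λ u → 𝟙 (T? (lookup (false ∷ S) u)))) k })))
         (count-small X′? s)) ⟩
  with₀ + suc (card X′?) ^ s
    ≤⟨ bound s refl (X? zero) ⟩
  suc (𝟙 (X? zero) + card X′?) ^ s
    ≡⟨ cong (λ a → suc a ^ s) (sym (∑-allFin-suc (λ u → 𝟙 (X? u)))) ⟩
  suc (card X?) ^ s ∎
  where
  open ≤-Reasoning
  X′? : ∀ u → Dec (X (suc u))
  X′? u = X? (suc u)
  with₀ without₀ : ℕ
  with₀    = ∑[ S ∈ subsets n ] 𝟙 (small? X? s (true ∷ S))
  without₀ = ∑[ S ∈ subsets n ] 𝟙 (small? X? s (false ∷ S))
  empty : (∀ (S : Vec Bool n) → ¬ (Within X (true ∷ S) × size (true ∷ S) ≤ s)) → with₀ ≡ 0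
  empty h = trans (∑-cong (subsets n) (λ S → 𝟙-no (small? X? s (true ∷ S)) (h S))) (∑-zero (subsets n))
  size-true : (S : Vec Bool n) → size (true ∷ S) ≡ suc (size S)
  size-true S = ∑-allFin-suc (λ u → 𝟙 (T? (lookup (true ∷ S) u)))
  bound : ∀ r → s ≡ r → (x₀ : Dec (X zero)) → with₀ + suc (card X′?) ^ r ≤ suc (𝟙 x₀ + card X′?) ^ r
  bound r refl (no ¬x₀) = ≤-reflexive (cong (_+ suc (card X′?) ^ s) (empty (λ S h → ¬x₀ (proj₁ h zero _))))
  bound zero refl (yes _) = ≤-reflexive (cong (_+ 1) (empty (λ S h → case subst (_≤ 0) (size-true S) (proj₂ h) of λ ())))
  bound (suc r) refl (yes _) = begin
    with₀ + suc a ^ suc r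
      ≤⟨ +-monoˡ-≤ _ (≤-trans (∑-mono (subsets n) (λ S → 𝟙-mono (small? X? s (true ∷ S)) (small? X′? r S)
           (λ { (w , k) → (λ u → w (suc u)) , ≤-pred (subst (_≤ suc r) (size-true S) k) })))
           (count-small X′? r)) ⟩
    suc a ^ r + suc a * suc a ^ r
      ≤⟨ *-monoʳ-≤ (suc (suc a)) (^-monoˡ-≤ r (n≤1+n (suc a))) ⟩
    suc (suc a) ^ suc r ∎
    where
    a : ℕ
    a = card X′?

-- From `b * b` elements on, a vertex set has at least twice as many independent sets as subsets of
-- size at most 2m (`#ind-lower-card`). Below that size, `(b * b) ^ (2 * m)` bounds the number of
-- those subsets. The leading 2 comes from comparing the size with 2m in order to reach an average
-- of m.
threshold : ℕ → ℕ → ℕ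
threshold ω m = let b = (4 * ω) ^ suc (6 * m) in 2 * (b * b) ^ (2 * m)

-- Independent sets in graphs of bounded clique number

module Independent {n : ℕ} (G : Graph n) where

  _~_ : Fin n → Fin n → Set
  u ~ v = T (adj G u v)

  _~?_ : ∀ u v → Dec (u ~ v)
  u ~? v = T? (adj G u v)

  ~-sym : ∀ {u v} → u ~ v → v ~ u
  ~-sym {u} {v} = subst T (adj-sym G u v)

  ~-irrefl : ∀ {u} → ¬ (u ~ u)
  ~-irrefl {u} h = subst T (loopless G u) h

  _∖N?_ : {X : Fin n → Set} → (∀ u → Dec (X u)) → ∀ v u → Dec (X u × ¬ (v ~ u))
  (X? ∖N? v) u = X? u ×-dec ¬? (v ~? u)

  _∩N?_ : {X : Fin n → Set} → (∀ u → Dec (X u)) → ∀ v u → Dec (X u × v ~ u)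
  (X? ∩N? v) u = X? u ×-dec (v ~? u)

  card-split : {X : Fin n → Set} (X? : ∀ u → Dec (X u)) (v : Fin n) →
               card X? ≡ card (X? ∩N? v) + card (X? ∖N? v)
  card-split X? v = trans (∑-cong (allFin n) pointwise) (∑-+ (allFin n) _ _)
    where
    pointwise : ∀ u → 𝟙 (X? u) ≡ 𝟙 ((X? ∩N? v) u) + 𝟙 ((X? ∖N? v) u)
    pointwise u with X? u | adj G v u
    ... | yes _ | true  = refl
    ... | yes _ | false = refl
    ... | no _  | _     = refl

  -- Greedy cliques and vertices with many non-neighbours

  Clique : ℕ → (Fin n → Set) → Set
  Clique j X = Σ (Fin j → Fin n) λ f → IsClique G f × (∀ i → X (f i))

  clique-suc : ∀ {j} {X : Fin n → Set} v → X v → Clique j (λ u → X u × v ~ u) → Clique (suc j) X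
  clique-suc {j} {X} v v∈X (f , (inj , adjacent) , f∈) = g , (g-injective _ _ , g-adjacent) , g∈
    where
    g : Fin (suc j) → Fin n
    g zero    = v
    g (suc i) = f i
    f≢v : ∀ i → f i ≢ v
    f≢v i e = ~-irrefl (subst (v ~_) e (proj₂ (f∈ i)))
    g-injective : ∀ i k → g i ≡ g k → i ≡ k
    g-injective zero    zero    e = refl
    g-injective zero    (suc k) e = contradiction (sym e) (f≢v k)
    g-injective (suc i) zero    e = contradiction e (f≢v i)
    g-injective (suc i) (suc k) e = cong suc (inj e)
    g-adjacent : ∀ i k → i ≢ k → g i ~ g k
    g-adjacent zero    zero    h = contradiction refl h
    g-adjacent zero    (suc k) h = proj₂ (f∈ k)
    g-adjacent (suc i) zero    h = ~-sym (proj₂ (f∈ i))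
    g-adjacent (suc i) (suc k) h = adjacent i k (h ∘ cong suc)
    g∈ : ∀ i → X (g i)
    g∈ zero    = v∈X
    g∈ (suc i) = proj₁ (f∈ i)

  module _ (ω : ℕ) where

    -- Passing from Y to the neighbours of a vertex of Y lowers ω |Y| by less than |X|, so j such
    -- passages are affordable. The loss is strictly smaller, so Y is still nonempty after the last
    -- passage; this gives the extra vertex in `suc j`.
    greedy-clique : ∀ {X : Fin n → Set} (X? : ∀ u → Dec (X u)) → (∀ v → X v → ω * card (X? ∖N? v) < card X?) →
                    ∀ j {Y : Fin n → Set} (Y? : ∀ u → Dec (Y u)) → (∀ u → Y u → X u) → ∃ Y →
                    j * card X? ≤ ω * card Y? → Clique (suc j) Y
    greedy-clique X? dense zero    Y? Y⊆X (v , v∈Y) h =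
      clique-suc v v∈Y ((λ ()) , ((λ { {()} }) , λ ()) , λ ())
    greedy-clique {X} X? dense (suc j) {Y} Y? Y⊆X (v , v∈Y) h =
      clique-suc v v∈Y (greedy-clique X? dense j (Y? ∩N? v) (λ u → Y⊆X u ∘ proj₁)
        (∑-positive (allFin n) (Y? ∩N? v)
          (n≢0⇒n>0 λ e → <⇒≱ bound (subst (_≤ j * card X?) (sym (trans (cong (ω *_) e) (*-zeroʳ ω))) z≤n)))
        (<⇒≤ bound))
      where
      open ≤-Reasoning
      bound : j * card X? < ω * card (Y? ∩N? v)
      bound = +-cancelˡ-< (card X?) _ _ (begin-strict
        suc j * card X?
          ≤⟨ h ⟩
        ω * card Y?
          ≡⟨ cong (ω *_) (card-split Y? v) ⟩
        ω * (card (Y? ∩N? v) + card (Y? ∖N? v))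
          ≡⟨ *-distribˡ-+ ω (card (Y? ∩N? v)) _ ⟩
        ω * card (Y? ∩N? v) + ω * card (Y? ∖N? v)
          ≤⟨ +-monoʳ-≤ _ (*-monoʳ-≤ ω (card-mono (Y? ∖N? v) (X? ∖N? v) (λ { u (y , k) → Y⊆X u y , k }))) ⟩
        ω * card (Y? ∩N? v) + ω * card (X? ∖N? v)
          <⟨ +-monoʳ-< _ (dense v (Y⊆X v v∈Y)) ⟩
        ω * card (Y? ∩N? v) + card X?
          ≡⟨ +-comm _ (card X?) ⟩
        card X? + ω * card (Y? ∩N? v) ∎)

    -- Otherwise `greedy-clique`, started at Y = X with j = ω, finds a clique of ω + 1 vertices.
    sparse-vertex : CliqueNumber≤ G ω → ∀ {X : Fin n → Set} (X? : ∀ u → Dec (X u)) → ∃ X →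
                    ∃ λ v → X v × card X? ≤ ω * card (X? ∖N? v)
    sparse-vertex ω-bound X? nonempty
      with any? (λ v → X? v ×-dec (card X? ≤? ω * card (X? ∖N? v)))
    ... | yes h = h
    ... | no ¬h =
      let f , clique , _ = greedy-clique X? (λ v x → ≰⇒> (λ k → ¬h (v , x , k))) ω X? (λ _ x → x) nonempty ≤-refl
      in contradiction (ω-bound (suc ω) f clique) 1+n≰n

  -- Independent sets and their recursion at a vertex

  Ind : (Fin n → Set) → Vec Bool n → Set
  Ind X S = Within X S × (∀ u → T (lookup S u) → ∀ w → T (lookup S w) → ¬ (u ~ w))

  ind? : ∀ {X : Fin n → Set} → (∀ u → Dec (X u)) → ∀ S → Dec (Ind X S)
  ind? X? S = within? X? S ×-dec
    all? (λ u → T? (lookup S u) →-dec all? (λ w → T? (lookup S w) →-dec ¬? (u ~? w)))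

  #ind : ∀ {X : Fin n → Set} → (∀ u → Dec (X u)) → ℕ
  #ind X? = ∑[ S ∈ subsets n ] 𝟙 (ind? X? S)

  mult-subsets : ∀ S → Multiplicity.mult (Vec-≡-dec Bool._≟_) S (subsets n) ≡ 1
  mult-subsets S = mult-vecs Bool._≟_ _ S (λ i → mult-bool (lookup S i))
    where
    mult-bool : ∀ b → Multiplicity.mult Bool._≟_ b (true ∷ false ∷ []) ≡ 1
    mult-bool true  = refl
    mult-bool false = refl

  -- The first term counts sets that avoid v. Inserting v is a bijection from the sets counted by
  -- the second term to the independent sets of X that contain v.
  #ind-split : ∀ {X : Fin n → Set} (X? : ∀ u → Dec (X u)) v → X v →
               #ind (X? ∖? v) + #ind ((X? ∖N? v) ∖? v) ≤ #ind X?
  #ind-split {X} X? v v∈X = begin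
    #ind (X? ∖? v) + #ind ((X? ∖N? v) ∖? v)
      ≡⟨ cong (#ind (X? ∖? v) +_) (trans (∑-cong (subsets n) (λ S → sym (*-identityʳ _)))
           (trans (∑-bijection (Vec-≡-dec Bool._≟_) (Vec-≡-dec Bool._≟_) (subsets n) (subsets n)
             (ind? ((X? ∖N? v) ∖? v)) with-v? (_[ v ]≔ true) (_[ v ]≔ false) (λ _ → 1) (λ _ → 1)
             insert delete (λ S _ → mult-subsets S) (λ S _ → mult-subsets S))
             (∑-cong (subsets n) (λ S → *-identityʳ _)))) ⟩
    #ind (X? ∖? v) + ∑[ S ∈ subsets n ] 𝟙 (with-v? S)
      ≡⟨ sym (∑-+ (subsets n) _ _) ⟩
    ∑[ S ∈ subsets n ] (𝟙 (ind? (X? ∖? v) S) + 𝟙 (with-v? S))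
      ≤⟨ ∑-mono (subsets n) pointwise ⟩
    #ind X? ∎
    where
    open ≤-Reasoning
    with-v? : ∀ S → Dec (Ind X S × T (lookup S v))
    with-v? S = ind? X? S ×-dec T? (lookup S v)
    insert⁻ : ∀ (S : Vec Bool n) u → T (lookup (S [ v ]≔ true) u) → u ≡ v ⊎ T (lookup S u)
    insert⁻ S u h with u Fin.≟ v
    ... | yes e = inj₁ e
    ... | no u≢v = inj₂ (subst T (lookup∘update′ u≢v S true) h)
    delete⁻ : ∀ (S : Vec Bool n) u → T (lookup (S [ v ]≔ false) u) → u ≢ v × T (lookup S u)
    delete⁻ S u h with u Fin.≟ v
    ... | yes refl = ⊥-elim (subst T (lookup∘update v S false) h)
    ... | no u≢v = u≢v , subst T (lookup∘update′ u≢v S false) h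
    restore : ∀ (S : Vec Bool n) {b} b′ → lookup S v ≡ b → (S [ v ]≔ b′) [ v ]≔ b ≡ S
    restore S b′ refl = trans ([]≔-idempotent S v) ([]≔-lookup S v)
    insert : ∀ S → Ind (λ u → (X u × ¬ (v ~ u)) × u ≢ v) S →
             (Ind X (S [ v ]≔ true) × T (lookup (S [ v ]≔ true) v)) ×
             (S [ v ]≔ true) [ v ]≔ false ≡ S × 1 ≡ 1
    insert S (within , indep) = ((within′ , indep′) , subst T (sym (lookup∘update v S true)) _) ,
                                restore S true (v∉ (lookup S v) refl) , refl
      where
      v∉ : ∀ b → lookup S v ≡ b → lookup S v ≡ false
      v∉ true  e = contradiction refl (proj₂ (within v (subst T (sym e) _)))
      v∉ false e = e
      within′ : Within X (S [ v ]≔ true)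
      within′ u h with insert⁻ S u h
      ... | inj₁ refl = v∈X
      ... | inj₂ u∈S  = proj₁ (proj₁ (within u u∈S))
      indep′ : ∀ u → T (lookup (S [ v ]≔ true) u) → ∀ w → T (lookup (S [ v ]≔ true) w) → ¬ (u ~ w)
      indep′ u h w k with insert⁻ S u h | insert⁻ S w k
      ... | inj₁ refl | inj₁ refl = ~-irrefl
      ... | inj₁ refl | inj₂ w∈S  = proj₂ (proj₁ (within w w∈S))
      ... | inj₂ u∈S  | inj₁ refl = proj₂ (proj₁ (within u u∈S)) ∘ ~-sym
      ... | inj₂ u∈S  | inj₂ w∈S  = indep u u∈S w w∈S
    delete : ∀ S → Ind X S × T (lookup S v) →
             Ind (λ u → (X u × ¬ (v ~ u)) × u ≢ v) (S [ v ]≔ false) × (S [ v ]≔ false) [ v ]≔ true ≡ S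
    delete S ((within , indep) , v∈S) =
      ((λ u h → let u≢v , u∈S = delete⁻ S u h in (within u u∈S , indep v v∈S u u∈S) , u≢v) ,
       (λ u h w k → indep u (proj₂ (delete⁻ S u h)) w (proj₂ (delete⁻ S w k)))) ,
      restore S false (T⇒≡ v∈S)
      where
      T⇒≡ : ∀ {b} → T b → b ≡ true
      T⇒≡ {true} _ = refl
    pointwise : ∀ S → 𝟙 (ind? (X? ∖? v) S) + 𝟙 (with-v? S) ≤ 𝟙 (ind? X? S)
    pointwise S = 𝟙-disjoint (ind? (X? ∖? v) S) (with-v? S) (ind? X? S)
      (λ { (within , indep) → (λ u h → proj₁ (within u h)) , indep }) proj₁
      (λ { (within , _) (_ , v∈S) → proj₂ (within v v∈S) refl })

  #ind-positive : ∀ {X : Fin n → Set} (X? : ∀ u → Dec (X u)) → 1 ≤ #ind X?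
  #ind-positive {X} X? = begin
    1
      ≡⟨ sym (mult-subsets ∅) ⟩
    ∑[ S ∈ subsets n ] 𝟙 (Vec-≡-dec Bool._≟_ S ∅)
      ≤⟨ ∑-mono (subsets n) (λ S → 𝟙-mono (Vec-≡-dec Bool._≟_ S ∅) (ind? X? S)
           (λ { refl → (λ u h → ⊥-elim (∉∅ u h)) , λ u h → ⊥-elim (∉∅ u h) })) ⟩
    #ind X? ∎
    where
    open ≤-Reasoning
    ∅ : Vec Bool n
    ∅ = Vec.replicate n false
    ∉∅ : ∀ u → ¬ T (lookup ∅ u)
    ∉∅ u h = subst T (lookup-replicate u false) h

  -- Number and average size of independent sets

  module _ {ω : ℕ} .{{_ : NonZero ω}} (ω-bound : CliqueNumber≤ G ω) where

    private
      4ω≢0 : NonZero (4 * ω)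
      4ω≢0 = m*n≢0 4 ω

      -- A sparse vertex v splits off the independent sets of X ∖ N[v], and X ∖ {v} is still large.
      peel : ∀ M a → 1 ≤ M →
             (∀ {X : Fin n → Set} (X? : ∀ u → Dec (X u)) → M ≤ card X? → a ≤ #ind X?) →
             ∀ j {X : Fin n → Set} (X? : ∀ u → Dec (X u)) → j + ω * (2 * M) ≤ card X? → j * a ≤ #ind X?
      peel M a 1≤M large zero    X? h = z≤n
      peel M a 1≤M large (suc j) X? h
        with sparse-vertex ω ω-bound X? (∑-positive (allFin n) X? (≤-trans (s≤s z≤n) h))
      ... | v , v∈X , sparse = begin
        a + j * a
          ≡⟨ +-comm a _ ⟩
        j * a + a
          ≤⟨ +-mono-≤ (peel M a 1≤M large j (X? ∖? v) (≤-pred (≤-trans h (card-∖ X? v))))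
                      (large ((X? ∖N? v) ∖? v) (≤-pred (≤-trans M<X∖N (card-∖ (X? ∖N? v) v)))) ⟩
        #ind (X? ∖? v) + #ind ((X? ∖N? v) ∖? v)
          ≤⟨ #ind-split X? v v∈X ⟩
        #ind X? ∎
        where
        open ≤-Reasoning
        -- The non-neighbours of v include v itself. The factor 2 in front of M leaves room to
        -- delete it.
        M<X∖N : suc M ≤ card (X? ∖N? v)
        M<X∖N = begin
          1 + M      ≤⟨ +-monoˡ-≤ M 1≤M ⟩
          M + M      ≡⟨ cong (M +_) (sym (+-identityʳ M)) ⟩
          2 * M      ≤⟨ *-cancelˡ-≤ ω (≤-trans (≤-trans (m≤n+m _ (suc j)) h) sparse) ⟩
          card (X? ∖N? v) ∎

    -- A round of a peelings multiplies the count by a and costs a factor 4ω in the size of X: one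
    -- 2ωM keeps the sets of non-neighbours large, and another absorbs the a deleted vertices.
    #ind-lower : ∀ a → 1 ≤ a → ∀ s {X : Fin n → Set} (X? : ∀ u → Dec (X u)) →
                 a * (4 * ω) ^ s ≤ card X? → a ^ s ≤ #ind X?
    #ind-lower a 1≤a zero    X? h = #ind-positive X?
    #ind-lower a 1≤a (suc s) X? h =
      peel M (a ^ s) (≤-trans 1≤a a≤M) (#ind-lower a 1≤a s) a X? (begin
        a + ω * (2 * M)           ≤⟨ +-monoˡ-≤ _ (≤-trans a≤M (≤-trans (m≤n*m M ω) (*-monoʳ-≤ ω (m≤n*m M 2)))) ⟩
        ω * (2 * M) + ω * (2 * M) ≡⟨ regroup ω a ((4 * ω) ^ s) ⟩
        a * (4 * ω) ^ suc s       ≤⟨ h ⟩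
        card X?                   ∎)
      where
      open ≤-Reasoning
      M : ℕ
      M = a * (4 * ω) ^ s
      a≤M : a ≤ M
      a≤M = m≤m*n a ((4 * ω) ^ s) {{m^n≢0 (4 * ω) s {{4ω≢0}}}}
      regroup : ∀ ω a p → ω * (2 * (a * p)) + ω * (2 * (a * p)) ≡ a * (4 * ω * p)
      regroup = solve-∀

    -- With q = |X| / b and b ≤ q one has |X| + 1 ≤ (q + 1) b ≤ q³, so the left side is at most q ·
    -- q^(6m) = q^(6m+1). This is the bound of `#ind-lower` for s = 6m + 1, and explains the
    -- exponent in b.
    #ind-lower-card : ∀ m {X : Fin n → Set} (X? : ∀ u → Dec (X u)) →
                      let b = (4 * ω) ^ suc (6 * m) in b * b ≤ card X? →
                      2 * suc (card X?) ^ (2 * m) ≤ #ind X?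
    #ind-lower-card m X? h = begin
      2 * suc (card X?) ^ (2 * m)
        ≤⟨ *-mono-≤ 2≤q (^-monoˡ-≤ (2 * m) (begin
             suc (card X?)       ≤⟨ X<[1+q]b ⟩
             suc q * b           ≤⟨ *-mono-≤ (≤-trans (+-monoˡ-≤ q (≤-trans (s≤s z≤n) 2≤q)) q+q≤q*q) b≤q ⟩
             q * q * q           ≡⟨ cube q ⟩
             q ^ 3               ∎)) ⟩
      q * (q ^ 3) ^ (2 * m)
        ≡⟨ cong (q *_) (trans (^-*-assoc q 3 (2 * m)) (cong (q ^_) (sym (*-assoc 3 2 m)))) ⟩
      q ^ suc (6 * m)
        ≤⟨ #ind-lower q (≤-trans (s≤s z≤n) 2≤q) (suc (6 * m)) X? (m/n*n≤m (card X?) b) ⟩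
      #ind X? ∎
      where
      open ≤-Reasoning
      b : ℕ
      b = (4 * ω) ^ suc (6 * m)
      instance
        b≢0 : NonZero b
        b≢0 = m^n≢0 (4 * ω) (suc (6 * m)) {{4ω≢0}}
      q : ℕ
      q = card X? / b
      b≤q : b ≤ q
      b≤q = subst (_≤ q) (m*n/n≡m b b) (/-monoˡ-≤ b h)
      2≤q : 2 ≤ q
      2≤q = begin
        2                              ≤⟨ s≤s (s≤s z≤n) ⟩
        4 * 1                          ≤⟨ *-monoʳ-≤ 4 (>-nonZero⁻¹ ω) ⟩
        4 * ω                          ≤⟨ m≤m*n (4 * ω) ((4 * ω) ^ (6 * m)) {{m^n≢0 (4 * ω) (6 * m) {{4ω≢0}}}} ⟩
        b                              ≤⟨ b≤q ⟩
        q                              ∎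
      q+q≤q*q : q + q ≤ q * q
      q+q≤q*q = subst (_≤ q * q) (cong (q +_) (+-identityʳ q)) (*-monoˡ-≤ q 2≤q)
      X<[1+q]b : card X? < suc q * b
      X<[1+q]b = begin-strict
        card X?              ≡⟨ m≡m%n+[m/n]*n (card X?) b ⟩
        card X? % b + q * b  <⟨ +-monoˡ-< (q * b) (m%n<n (card X?) b) ⟩
        suc q * b            ∎
      cube : ∀ q → q * q * q ≡ q * (q * (q * 1))
      cube = solve-∀

    -- Either there are at most threshold ω m independent sets, or at least half of them have more than 2m elements.
    ind-average : ∀ m {X : Fin n → Set} (X? : ∀ u → Dec (X u)) →
                  m * #ind X? ≤ m * threshold ω m + ∑[ S ∈ subsets n ] (𝟙 (ind? X? S) * size S)
    ind-average m {X} X? = case <-≤-connex (card X?) (b * b) of λ where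
        (inj₁ few)  → begin
          m * #ind X?                        ≤⟨ m≤n+m _ (m * #ind X?) ⟩
          m * #ind X? + m * #ind X?          ≤⟨ mass ⟩
          m * (2 * small) + total            ≤⟨ +-monoˡ-≤ total (*-monoʳ-≤ m (*-monoʳ-≤ 2
                                                  (≤-trans (count-small X? (2 * m)) (^-monoˡ-≤ (2 * m) few)))) ⟩
          m * threshold ω m + total            ∎
        (inj₂ many) → +-cancelˡ-≤ (m * #ind X?) _ _ (begin
          m * #ind X? + m * #ind X?               ≤⟨ mass ⟩
          m * (2 * small) + total                 ≤⟨ +-monoˡ-≤ total (*-monoʳ-≤ m (≤-trans
                                                       (*-monoʳ-≤ 2 (count-small X? (2 * m)))
                                                       (#ind-lower-card m X? many))) ⟩
          m * #ind X? + total                     ≤⟨ +-monoʳ-≤ (m * #ind X?) (m≤n+m total (m * threshold ω m)) ⟩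
          m * #ind X? + (m * threshold ω m + total) ∎)
      where
      open ≤-Reasoning
      b small total : ℕ
      b     = (4 * ω) ^ suc (6 * m)
      small = ∑[ S ∈ subsets n ] 𝟙 (small? X? (2 * m) S)
      total = ∑[ S ∈ subsets n ] (𝟙 (ind? X? S) * size S)
      -- Sets with more than 2m elements pay 2m by their own size; the others are charged to
      -- `small`.
      pointwise : ∀ S → (m + m) * 𝟙 (ind? X? S) ≤ m * 2 * 𝟙 (small? X? (2 * m) S) + 𝟙 (ind? X? S) * size S
      pointwise S = cases (ind? X? S) (size S ≤? 2 * m)
        where
        2m≡ : ∀ m → (m + m) * 1 ≡ 2 * m
        2m≡ = solve-∀
        2m≡′ : ∀ m → (m + m) * 1 ≡ m * 2 * 1
        2m≡′ = solve-∀
        cases : (i : Dec (Ind X S)) → Dec (size S ≤ 2 * m) →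
                (m + m) * 𝟙 i ≤ m * 2 * 𝟙 (small? X? (2 * m) S) + 𝟙 i * size S
        cases (no _) _ = ≤-trans (≤-reflexive (*-zeroʳ (m + m))) z≤n
        cases (yes (within , _)) (yes S≤2m) = begin
          (m + m) * 1                                      ≡⟨ 2m≡′ m ⟩
          m * 2 * 1                                        ≡⟨ cong (m * 2 *_) (sym (𝟙-yes (small? X? (2 * m) S) (within , S≤2m))) ⟩
          m * 2 * 𝟙 (small? X? (2 * m) S)                  ≤⟨ m≤m+n _ _ ⟩
          m * 2 * 𝟙 (small? X? (2 * m) S) + 1 * size S     ∎
        cases (yes _) (no S≰2m) = begin
          (m + m) * 1                                      ≡⟨ 2m≡ m ⟩
          2 * m                                            ≤⟨ <⇒≤ (≰⇒> S≰2m) ⟩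
          size S                                           ≡⟨ sym (*-identityˡ (size S)) ⟩
          1 * size S                                       ≤⟨ m≤n+m _ (m * 2 * 𝟙 (small? X? (2 * m) S)) ⟩
          m * 2 * 𝟙 (small? X? (2 * m) S) + 1 * size S     ∎
      mass : m * #ind X? + m * #ind X? ≤ m * (2 * small) + total
      mass = begin
        m * #ind X? + m * #ind X?
          ≡⟨ sym (*-distribʳ-+ (#ind X?) m m) ⟩
        (m + m) * #ind X?
          ≡⟨ sym (∑-*ˡ (subsets n) (m + m) _) ⟩
        ∑[ S ∈ subsets n ] ((m + m) * 𝟙 (ind? X? S))
          ≤⟨ ∑-mono (subsets n) pointwise ⟩
        ∑[ S ∈ subsets n ] (m * 2 * 𝟙 (small? X? (2 * m) S) + 𝟙 (ind? X? S) * size S)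
          ≡⟨ ∑-+ (subsets n) _ _ ⟩
        ∑[ S ∈ subsets n ] (m * 2 * 𝟙 (small? X? (2 * m) S)) + total
          ≡⟨ cong (_+ total) (trans (∑-*ˡ (subsets n) (m * 2) _) (*-assoc m 2 small)) ⟩
        m * (2 * small) + total ∎

-- Overriding a colouring on a set of vertices

does⁻ : {P : Set} (p : Dec P) → T (does p) → P
does⁻ (yes h) _ = h

does⁺ : {P : Set} (p : Dec P) → P → T (does p)
does⁺ p h = subst T (sym (dec-true p h)) _

override : ∀ {n} {X : Fin n → Set} → (∀ u → Dec (X u)) → (Fin n → ℕ) → Vec ℕ n → Vec ℕ n
override X? new c = Vec.tabulate (λ u → if does (X? u) then new u else lookup c u)

module _ {n} {X : Fin n → Set} (X? : ∀ u → Dec (X u)) (new : Fin n → ℕ) (c : Vec ℕ n) {u : Fin n} where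

  override-∈ : X u → lookup (override X? new c) u ≡ new u
  override-∈ h rewrite lookup∘tabulate (λ u → if does (X? u) then new u else lookup c u) u | dec-true (X? u) h = refl

  override-∉ : ¬ X u → lookup (override X? new c) u ≡ lookup c u
  override-∉ h rewrite lookup∘tabulate (λ u → if does (X? u) then new u else lookup c u) u | dec-false (X? u) h = refl

-- The colour 0 marks uncoloured vertices.
module Colouring {n : ℕ} (G : Graph n) (L : Fin n → List ℕ)
                 (L-unique : ∀ u → Unique (L u)) (L-positive : ∀ u → 0 ∉ L u) where
  open Independent G
  open Multiplicity _≟_

  -- All neighbours may be quantified over, since an uncoloured one carries 0, which lies in no list
  -- and so blocks no colour of `L u`.
  Free : Vec ℕ n → Fin n → ℕ → Set
  Free c u a = ∀ w → u ~ w → lookup c w ≢ a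

  free? : ∀ c u a → Dec (Free c u a)
  free? c u a = all? (λ w → (u ~? w) →-dec ¬? (lookup c w ≟ a))

  #free : Vec ℕ n → Fin n → ℕ
  #free c u = ∑[ a ∈ L u ] 𝟙 (free? c u a)

  AgreeAround : Fin n → Vec ℕ n → Vec ℕ n → Set
  AgreeAround u c d = ∀ w → u ~ w → lookup c w ≡ lookup d w

  free-cong : ∀ c d {u a} → AgreeAround u c d → Free c u a → Free d u a
  free-cong c d h f w k e = f w k (trans (h w k) e)

  free-cong⁻ : ∀ c d {u a} → AgreeAround u c d → Free d u a → Free c u a
  free-cong⁻ c d h = free-cong d c (λ w k → sym (h w k))

  #free-cong : ∀ c d {u} → AgreeAround u c d → #free c u ≡ #free d u
  #free-cong c d {u} h = ∑-cong (L u) (λ a →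
    𝟙-cong (free? c u a) (free? d u a) (free-cong c d h) (free-cong⁻ c d h))

  -- Partial colourings and their extension by one vertex

  Col : (Fin n → Set) → Vec ℕ n → Set
  Col U c = ∀ u → (U u → lookup c u ∈ L u × Free c u (lookup c u)) × (¬ U u → lookup c u ≡ 0)

  col? : {U : Fin n → Set} → (∀ u → Dec (U u)) → ∀ c → Dec (Col U c)
  col? U? c = all? (λ u → (U? u →-dec ((lookup c u ∈? L u) ×-dec free? c u (lookup c u)))
                     ×-dec (¬? (U? u) →-dec (lookup c u ≟ 0)))

  assignments : List (Vec ℕ n)
  assignments = vecs (λ u → 0 ∷ L u)

  #col : {U : Fin n → Set} → (∀ u → Dec (U u)) → ℕ
  #col U? = ∑[ c ∈ assignments ] 𝟙 (col? U? c)

  _≟ᶜ_ : DecidableEquality (Vec ℕ n)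
  _≟ᶜ_ = Vec-≡-dec _≟_

  mult-col : {U : Fin n → Set} (U? : ∀ u → Dec (U u)) → ∀ c → Col U c → Multiplicity.mult _≟ᶜ_ c assignments ≡ 1
  mult-col U? c col = mult-vecs _≟_ _ c (λ u →
    mult-∈ (All.tabulate (λ i e → L-positive u (subst (_∈ L u) (sym e) i)) ∷ L-unique u) (member u (U? u)))
    where
    member : ∀ u → Dec _ → lookup c u ∈ 0 ∷ L u
    member u (yes h) = there (proj₁ (proj₁ (col u) h))
    member u (no h)  = here (proj₂ (col u) h)

  module _ {U : Fin n → Set} (U? : ∀ u → Dec (U u)) (v : Fin n) (v∈U : U v) where

    -- A colouring of U amounts to a colouring of U ∖ {v} together with a colour free at v. The
    -- weight F ignores the colour of v, so the pair has the same weight as the colouring.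
    #col-extend : (F : Vec ℕ n → ℕ) → (∀ c a → F (c [ v ]≔ a) ≡ F c) →
                  ∑[ c ∈ assignments ] (𝟙 (col? U? c) * F c) ≡
                  ∑[ c ∈ assignments ] (𝟙 (col? (U? ∖? v) c) * (#free c v * F c))
    #col-extend F F-indep = begin
      ∑[ c ∈ assignments ] (𝟙 (col? U? c) * F c)
        ≡⟨ ∑-bijection _≟ᶜ_ (×-≡-dec _≟ᶜ_ _≟_) assignments (pairs assignments (L v)) (col? U?) ext?
             (λ c → c [ v ]≔ 0 , lookup c v) (λ { (c , a) → c [ v ]≔ a }) F (λ { (c , a) → F c })
             restrict extend (mult-col U?)
             (λ { (c , a) (col , a∈ , _) → mult-pairs _≟ᶜ_ _≟_ c a assignments (L v) (mult-col (U? ∖? v) c col) (mult-∈ (L-unique v) a∈) }) ⟩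
      ∑[ ca ∈ pairs assignments (L v) ] (𝟙 (ext? ca) * F (proj₁ ca))
        ≡⟨ ∑-pairs assignments (L v) _ ⟩
      ∑[ c ∈ assignments ] ∑[ a ∈ L v ] (𝟙 (ext? (c , a)) * F c)
        ≡⟨ ∑-cong assignments (λ c → trans (∑-*ʳ (L v) (F c) _) (trans (cong (_* F c) (inner c))
             (*-assoc (𝟙 (col? (U? ∖? v) c)) (#free c v) (F c)))) ⟩
      ∑[ c ∈ assignments ] (𝟙 (col? (U? ∖? v) c) * (#free c v * F c)) ∎
      where
      open ≡-Reasoning
      Ext : Vec ℕ n × ℕ → Set
      Ext (c , a) = Col (λ u → U u × u ≢ v) c × a ∈ L v × Free c v a
      ext? : ∀ ca → Dec (Ext ca)
      ext? (c , a) = col? (U? ∖? v) c ×-dec ((a ∈? L v) ×-dec free? c v a)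
      inner : ∀ c → ∑[ a ∈ L v ] 𝟙 (ext? (c , a)) ≡ 𝟙 (col? (U? ∖? v) c) * #free c v
      inner c = trans
        (∑-cong-∈ (L v) (λ a i → trans (𝟙-× (col? (U? ∖? v) c) ((a ∈? L v) ×-dec free? c v a))
          (cong (𝟙 (col? (U? ∖? v) c) *_) (𝟙-cong ((a ∈? L v) ×-dec free? c v a) (free? c v a) proj₂ (i ,_)))))
        (∑-*ˡ (L v) (𝟙 (col? (U? ∖? v) c)) _)
      restrict : ∀ c → Col U c → Ext (c [ v ]≔ 0 , lookup c v) × (c [ v ]≔ 0) [ v ]≔ lookup c v ≡ c × F c ≡ F (c [ v ]≔ 0)
      restrict c col = (col′ , proj₁ (proj₁ (col v) v∈U) , free-cong⁻ (c [ v ]≔ 0) c off (proj₂ (proj₁ (col v) v∈U))) ,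
                       trans ([]≔-idempotent c v) ([]≔-lookup c v) , sym (F-indep c 0)
        where
        off : ∀ w → v ~ w → lookup (c [ v ]≔ 0) w ≡ lookup c w
        off w k = lookup∘update′ (λ { refl → ~-irrefl k }) c 0
        col′ : Col (λ u → U u × u ≢ v) (c [ v ]≔ 0)
        col′ u with u Fin.≟ v
        ... | yes refl = (λ { (_ , h) → contradiction refl h }) , λ _ → lookup∘update v c 0
        ... | no u≢v rewrite lookup∘update′ u≢v c 0 =
          (λ { (u∈U , _) → let a∈ , free = proj₁ (col u) u∈U in a∈ , free′ a∈ free }) ,
          λ h → proj₂ (col u) (λ u∈U → h (u∈U , u≢v))
          where
          free′ : lookup c u ∈ L u → Free c u (lookup c u) → Free (c [ v ]≔ 0) u (lookup c u)
          free′ a∈ free w k e with w Fin.≟ v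
          ... | yes refl = L-positive u (subst (_∈ L u) (trans (sym e) (lookup∘update v c 0)) a∈)
          ... | no w≢v   = free w k (trans (sym (lookup∘update′ w≢v c 0)) e)
      extend : ∀ ca → Ext ca → Col U (proj₁ ca [ v ]≔ proj₂ ca) ×
               ((proj₁ ca [ v ]≔ proj₂ ca) [ v ]≔ 0 , lookup (proj₁ ca [ v ]≔ proj₂ ca) v) ≡ ca
      extend (c , a) (col , a∈ , free) = col′ , cong₂ _,_
        (trans ([]≔-idempotent c v) (trans (cong (c [ v ]≔_) (sym (proj₂ (col v) (λ { (_ , h) → h refl })))) ([]≔-lookup c v)))
        (lookup∘update v c a)
        where
        col′ : Col U (c [ v ]≔ a)
        col′ u with u Fin.≟ v
        ... | yes refl rewrite lookup∘update v c a =
          (λ _ → a∈ , free-cong⁻ (c [ v ]≔ a) c (λ w k → lookup∘update′ (λ { refl → ~-irrefl k }) c a) free) ,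
          λ h → contradiction v∈U h
        ... | no u≢v rewrite lookup∘update′ u≢v c a =
          (λ u∈U → let b∈ , free-u = proj₁ (col u) (u∈U , u≢v) in b∈ , free′ free-u) ,
          λ h → proj₂ (col u) (h ∘ proj₁)
          where
          free′ : Free c u (lookup c u) → Free (c [ v ]≔ a) u (lookup c u)
          free′ free-u w k e with w Fin.≟ v
          ... | yes refl = free u (~-sym k) (trans (sym e) (lookup∘update v c a))
          ... | no w≢v   = free-u w k (trans (sym (lookup∘update′ w≢v c a)) e)

    #col-free : #col U? ≡ ∑[ c ∈ assignments ] (𝟙 (col? (U? ∖? v) c) * #free c v)
    #col-free = trans (∑-cong assignments (λ c → sym (*-identityʳ _)))
      (trans (#col-extend (λ _ → 1) (λ _ _ → refl))
             (∑-cong assignments (λ c → cong (𝟙 (col? (U? ∖? v) c) *_) (*-identityʳ _))))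

    -- In a colouring with #free c v ≤ 1, the colour of v is determined by the others.
    #col-tight : ∑[ c ∈ assignments ] (𝟙 (col? U? c) * 𝟙 (#free c v ≤? 1)) ≤ #col (U? ∖? v)
    #col-tight = begin
      ∑[ c ∈ assignments ] (𝟙 (col? U? c) * 𝟙 (#free c v ≤? 1))
        ≡⟨ #col-extend (λ c → 𝟙 (#free c v ≤? 1)) (λ c a → cong (λ k → 𝟙 (k ≤? 1))
             (#free-cong (c [ v ]≔ a) c (λ w k → lookup∘update′ (λ { refl → ~-irrefl k }) c a))) ⟩
      ∑[ c ∈ assignments ] (𝟙 (col? (U? ∖? v) c) * (#free c v * 𝟙 (#free c v ≤? 1)))
        ≤⟨ ∑-mono assignments (λ c → ≤-trans (*-monoʳ-≤ (𝟙 (col? (U? ∖? v) c)) (tight (#free c v)))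
             (≤-reflexive (*-identityʳ _))) ⟩
      #col (U? ∖? v) ∎
      where
      open ≤-Reasoning
      tight : ∀ k → k * 𝟙 (k ≤? 1) ≤ 1
      tight 0             = z≤n
      tight 1             = ≤-refl
      tight (suc (suc k)) = ≤-trans (≤-reflexive (*-zeroʳ (suc (suc k)))) z≤n

  -- Alternative colours and the switching bijection

  pick : List ℕ → ℕ
  pick []      = 0
  pick (a ∷ _) = a

  pick-∈ : ∀ {as} → 0 < length as → pick as ∈ as
  pick-∈ {a ∷ as} _ = here refl

  -- Which other free colour is taken is irrelevant, but it must be determined by the colours around
  -- u (`alternative-cong`): only then is a switch recognisable and reversible afterwards. The
  -- default 0 of `pick` is never met when u has two free colours.
  alternative : Vec ℕ n → ℕ → Fin n → ℕ
  alternative c x u = pick (filter (λ a → free? c u a ×-dec ¬? (a ≟ x)) (L u))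

  alternative-cong : ∀ c d {x u} → AgreeAround u c d → alternative c x u ≡ alternative d x u
  alternative-cong c d {x} {u} h = cong pick (filter-≐
    (λ a → free? c u a ×-dec ¬? (a ≟ x)) (λ a → free? d u a ×-dec ¬? (a ≟ x))
    ((λ { (f , k) → free-cong c d h f , k }) , λ { (f , k) → free-cong⁻ c d h f , k }) (L u))

  alternative-spec : ∀ c x u → 2 ≤ #free c u →
                     alternative c x u ∈ L u × Free c u (alternative c x u) × alternative c x u ≢ x
  alternative-spec c x u h = ∈-filter⁻ other? (pick-∈ (≤-pred (begin
    2                                               ≤⟨ h ⟩
    #free c u                                       ≤⟨ ∑-mono (L u) (λ a → pointwise a) ⟩
    ∑[ a ∈ L u ] (𝟙 (a ≟ x) + 𝟙 (other? a))         ≡⟨ ∑-+ (L u) _ _ ⟩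
    mult x (L u) + ∑[ a ∈ L u ] 𝟙 (other? a)        ≤⟨ +-mono-≤ (mult≤1 (L-unique u)) (≤-reflexive (sym (length-filter-∑ other? (L u)))) ⟩
    1 + length (filter other? (L u))                ∎)))
    where
    open ≤-Reasoning
    other? : ∀ a → Dec (Free c u a × a ≢ x)
    other? a = free? c u a ×-dec ¬? (a ≟ x)
    pointwise : ∀ a → 𝟙 (free? c u a) ≤ 𝟙 (a ≟ x) + 𝟙 (other? a)
    pointwise a = 𝟙-cover (free? c u a) (a ≟ x) (other? a) (λ f a≢x → f , a≢x)

  -- Among the vertices of X, those coloured x which could be coloured otherwise can switch to their alternative
  -- colour. A switched colouring together with an independent set of vertices to switch back determines the
  -- original colouring, so a random colouring restricts to a mixture of uniformly random independent sets.
  module Switching {U : Fin n → Set} (U? : ∀ u → Dec (U u)) {X : Fin n → Set} (X? : ∀ u → Dec (X u))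
                   (X⊆U : ∀ u → X u → U u) (x : ℕ) where

    Flexible : Vec ℕ n → Fin n → Set
    Flexible c u = X u × lookup c u ≡ x × 2 ≤ #free c u

    flexible? : ∀ c u → Dec (Flexible c u)
    flexible? c u = X? u ×-dec ((lookup c u ≟ x) ×-dec (2 ≤? #free c u))

    flexible : Vec ℕ n → Vec Bool n
    flexible c = Vec.tabulate (λ u → does (flexible? c u))

    ∈-flexible⁻ : ∀ c u → T (lookup (flexible c) u) → Flexible c u
    ∈-flexible⁻ c u h = does⁻ (flexible? c u) (subst T (lookup∘tabulate _ u) h)

    ∈-flexible⁺ : ∀ c u → Flexible c u → T (lookup (flexible c) u)
    ∈-flexible⁺ c u h = subst T (sym (lookup∘tabulate _ u)) (does⁺ (flexible? c u) h)

    Switched : Vec ℕ n → Set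
    Switched c = Col U c × (∀ u → ¬ Flexible c u)

    switched? : ∀ c → Dec (Switched c)
    switched? c = col? U? c ×-dec all? (λ u → ¬? (flexible? c u))

    -- The possible traces of a switch: vertices that the switch could have moved from x to where
    -- they are. In a switched colouring, any independent set of them can be moved back to x at
    -- once.
    Switchable : Vec ℕ n → Fin n → Set
    Switchable c u = X u × 2 ≤ #free c u × x ∈ L u × Free c u x × lookup c u ≡ alternative c x u

    switchable? : ∀ c u → Dec (Switchable c u)
    switchable? c u = X? u ×-dec ((2 ≤? #free c u) ×-dec ((x ∈? L u) ×-dec
                      (free? c u x ×-dec (lookup c u ≟ alternative c x u))))

    switch : Vec ℕ n → Vec ℕ n
    switch c = override (flexible? c) (alternative c x) c

    member? : (S : Vec Bool n) → ∀ u → Dec (T (lookup S u))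
    member? S u = T? (lookup S u)

    switchBack : Vec ℕ n × Vec Bool n → Vec ℕ n
    switchBack (c , S) = override (member? S) (λ _ → x) c

    module Forward (c : Vec ℕ n) (col : Col U c) where

      c′ : Vec ℕ n
      c′ = switch c

      on : ∀ u → Flexible c u → lookup c′ u ≡ alternative c x u
      on u = override-∈ (flexible? c) (alternative c x) c

      off : ∀ u → ¬ Flexible c u → lookup c′ u ≡ lookup c u
      off u = override-∉ (flexible? c) (alternative c x) c

      free-own : ∀ u → X u → Free c u (lookup c u)
      free-own u h = proj₂ (proj₁ (col u) (X⊆U u h))

      -- The neighbours of a vertex coloured x have other colours, so none of them is switched.
      x-agree : ∀ u → X u → lookup c u ≡ x → AgreeAround u c c′
      x-agree u u∈X cu≡x w u~w =
        sym (off w (λ { (_ , cw≡x , _) → free-own u u∈X w u~w (trans cw≡x (sym cu≡x)) }))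

      agree : ∀ u → Flexible c u → AgreeAround u c c′
      agree u (u∈X , cu≡x , _) = x-agree u u∈X cu≡x

      col′ : Col U c′
      col′ u with flexible? c u
      ... | yes f@(_ , _ , 2≤) rewrite on u f =
        (λ _ → let a∈ , free , _ = alternative-spec c x u 2≤ in a∈ , free-cong c c′ (agree u f) free) ,
        λ h → contradiction (X⊆U u (proj₁ f)) h
      ... | no ¬f rewrite off u ¬f = (λ u∈U → let a∈ , free = proj₁ (col u) u∈U in a∈ , free′ free) , proj₂ (col u)
        where
        free′ : Free c u (lookup c u) → Free c′ u (lookup c u)
        free′ free w u~w e with flexible? c w
        -- The alternative of w was free around w, so the neighbour u does not have this colour.
        ... | yes g@(_ , _ , 2≤) = proj₁ (proj₂ (alternative-spec c x w 2≤)) u (~-sym u~w) (trans (sym e) (on w g))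
        ... | no ¬g = free w u~w (trans (sym (off w ¬g)) e)

      -- A vertex that was switched no longer has colour x. One that still has it was left alone and
      -- sees the same colours as before, so it would have been flexible already.
      rigid : ∀ u → ¬ Flexible c′ u
      rigid u (u∈X , c′u≡x , 2≤′) with flexible? c u
      ... | yes f@(_ , _ , 2≤) = proj₂ (proj₂ (alternative-spec c x u 2≤)) (trans (sym (on u f)) c′u≡x)
      ... | no ¬f = ¬f (u∈X , cu≡x , subst (2 ≤_) (sym (#free-cong c c′ (x-agree u u∈X cu≡x))) 2≤′)
        where
        cu≡x : lookup c u ≡ x
        cu≡x = trans (sym (off u ¬f)) c′u≡x

      indep : Ind (Switchable c′) (flexible c)
      indep = within , λ u h w k u~w →
        let u∈X , cu≡x , _ = ∈-flexible⁻ c u h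
            _   , cw≡x , _ = ∈-flexible⁻ c w k
        in free-own u u∈X w u~w (trans cw≡x (sym cu≡x))
        where
        within : Within (Switchable c′) (flexible c)
        within u h with ∈-flexible⁻ c u h
        ... | f@(u∈X , cu≡x , 2≤) =
          u∈X ,
          subst (2 ≤_) (#free-cong c c′ (agree u f)) 2≤ ,
          subst (_∈ L u) cu≡x (proj₁ (proj₁ (col u) (X⊆U u u∈X))) ,
          free-cong c c′ (agree u f) (subst (Free c u) cu≡x (free-own u u∈X)) ,
          trans (on u f) (alternative-cong c c′ (agree u f))

      inverse : switchBack (c′ , flexible c) ≡ c
      inverse = lookup-injective pointwise
        where
        pointwise : ∀ u → lookup (switchBack (c′ , flexible c)) u ≡ lookup c u
        pointwise u with flexible? c u
        ... | yes f = trans (override-∈ (member? (flexible c)) (λ _ → x) c′ (∈-flexible⁺ c u f)) (sym (proj₁ (proj₂ f)))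
        ... | no ¬f = trans (override-∉ (member? (flexible c)) (λ _ → x) c′ (¬f ∘ ∈-flexible⁻ c u)) (off u ¬f)

    module Backward (c′ : Vec ℕ n) (S : Vec Bool n) (col′ : Col U c′) (rigid : ∀ u → ¬ Flexible c′ u)
                    (within : Within (Switchable c′) S)
                    (indep : ∀ u → T (lookup S u) → ∀ w → T (lookup S w) → ¬ (u ~ w)) where

      c : Vec ℕ n
      c = switchBack (c′ , S)

      on : ∀ u → T (lookup S u) → lookup c u ≡ x
      on u = override-∈ (member? S) (λ _ → x) c′

      off : ∀ u → ¬ T (lookup S u) → lookup c u ≡ lookup c′ u
      off u = override-∉ (member? S) (λ _ → x) c′

      agree : ∀ u → T (lookup S u) → AgreeAround u c′ c
      agree u u∈S w u~w = sym (off w (λ w∈S → indep u u∈S w w∈S u~w))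

      -- Members of S have x free in `c′`, so none of them is adjacent to a vertex coloured x.
      x-agree : ∀ u → lookup c′ u ≡ x → AgreeAround u c′ c
      x-agree u c′u≡x w u~w = sym (off w (λ w∈S →
        let _ , _ , _ , free , _ = within w w∈S in free u (~-sym u~w) c′u≡x))

      col : Col U c
      col u with member? S u
      ... | yes u∈S rewrite on u u∈S = let u∈X , _ , x∈ , free , _ = within u u∈S in
        (λ _ → x∈ , free-cong c′ c (agree u u∈S) free) , λ h → contradiction (X⊆U u u∈X) h
      ... | no u∉S rewrite off u u∉S = (λ u∈U → let a∈ , free = proj₁ (col′ u) u∈U in a∈ , free′ free) , proj₂ (col′ u)
        where
        free′ : Free c′ u (lookup c′ u) → Free c u (lookup c′ u)
        free′ free w u~w e with member? S w
        ... | yes w∈S = let _ , _ , _ , free-x , _ = within w w∈S in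
                        free-x u (~-sym u~w) (trans (sym e) (on w w∈S))
        ... | no w∉S = free w u~w (trans (sym (off w w∉S)) e)

      S⊆flexible : ∀ u → T (lookup S u) → Flexible c u
      S⊆flexible u u∈S = let u∈X , 2≤ , _ = within u u∈S in
        u∈X , on u u∈S , subst (2 ≤_) (#free-cong c′ c (agree u u∈S)) 2≤

      flexible⊆S : ∀ u → Flexible c u → T (lookup S u)
      flexible⊆S u (u∈X , cu≡x , 2≤) with member? S u
      ... | yes u∈S = u∈S
      ... | no u∉S = ⊥-elim (rigid u (u∈X , c′u≡x , subst (2 ≤_) (sym (#free-cong c′ c (x-agree u c′u≡x))) 2≤))
        where
        c′u≡x : lookup c′ u ≡ x
        c′u≡x = trans (sym (off u u∉S)) cu≡x

      flexible≡S : flexible c ≡ S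
      flexible≡S = lookup-injective (λ u → T-ext (S⊆flexible′ u) (flexible⊆S u ∘ ∈-flexible⁻ c u))
        where
        S⊆flexible′ : ∀ u → T (lookup S u) → T (lookup (flexible c) u)
        S⊆flexible′ u = ∈-flexible⁺ c u ∘ S⊆flexible u
        T-ext : ∀ {a b} → (T b → T a) → (T a → T b) → a ≡ b
        T-ext {true}  {true}  f g = refl
        T-ext {true}  {false} f g = ⊥-elim (g _)
        T-ext {false} {true}  f g = ⊥-elim (f _)
        T-ext {false} {false} f g = refl

      inverse : switch c ≡ c′
      inverse = lookup-injective pointwise
        where
        pointwise : ∀ u → lookup (switch c) u ≡ lookup c′ u
        pointwise u with member? S u
        ... | yes u∈S = let _ , _ , _ , _ , eq = within u u∈S in
          trans (override-∈ (flexible? c) (alternative c x) c (S⊆flexible u u∈S))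
                (trans (sym (alternative-cong c′ c (agree u u∈S))) (sym eq))
        ... | no u∉S =
          trans (override-∉ (flexible? c) (alternative c x) c (u∉S ∘ flexible⊆S u)) (off u u∉S)

    -- Used twice: constant ψ = 1 counts colourings, and ψ = `id` adds up the sizes of the flexible
    -- sets.
    ∑-switch : (ψ : ℕ → ℕ) →
      ∑[ c ∈ assignments ] (𝟙 (col? U? c) * ψ (size (flexible c))) ≡
      ∑[ c ∈ assignments ] (𝟙 (switched? c) * ∑[ S ∈ subsets n ] (𝟙 (ind? (switchable? c) S) * ψ (size S)))
    ∑-switch ψ = begin
      ∑[ c ∈ assignments ] (𝟙 (col? U? c) * ψ (size (flexible c)))
        ≡⟨ ∑-bijection _≟ᶜ_ (×-≡-dec _≟ᶜ_ (Vec-≡-dec Bool._≟_)) assignments (pairs assignments (subsets n)) (col? U?) pair?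
             (λ c → switch c , flexible c) switchBack (λ c → ψ (size (flexible c))) (λ { (c , S) → ψ (size S) })
             (λ c col → let open Forward c col in ((col′ , rigid) , indep) , inverse , refl)
             (λ { (c′ , S) ((col′ , rigid) , within , indep) →
                  let open Backward c′ S col′ rigid within indep in col , cong₂ _,_ inverse flexible≡S })
             (mult-col U?)
             (λ { (c′ , S) ((col′ , _) , _) →
                  mult-pairs _≟ᶜ_ (Vec-≡-dec Bool._≟_) c′ S assignments (subsets n) (mult-col U? c′ col′) (mult-subsets S) }) ⟩
      ∑[ cS ∈ pairs assignments (subsets n) ] (𝟙 (pair? cS) * ψ (size (proj₂ cS)))
        ≡⟨ ∑-pairs assignments (subsets n) _ ⟩
      ∑[ c ∈ assignments ] ∑[ S ∈ subsets n ] (𝟙 (pair? (c , S)) * ψ (size S))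
        ≡⟨ ∑-cong assignments (λ c → trans
             (∑-cong (subsets n) (λ S → trans (cong (_* ψ (size S)) (𝟙-× (switched? c) (ind? (switchable? c) S)))
               (*-assoc (𝟙 (switched? c)) (𝟙 (ind? (switchable? c) S)) (ψ (size S)))))
             (∑-*ˡ (subsets n) (𝟙 (switched? c)) _)) ⟩
      ∑[ c ∈ assignments ] (𝟙 (switched? c) * ∑[ S ∈ subsets n ] (𝟙 (ind? (switchable? c) S) * ψ (size S))) ∎
      where
      open ≡-Reasoning
      pair? : ∀ cS → Dec (Switched (proj₁ cS) × Ind (Switchable (proj₁ cS)) (proj₂ cS))
      pair? (c , S) = switched? c ×-dec ind? (switchable? c) S

    module _ {ω : ℕ} .{{_ : NonZero ω}} (ω-bound : CliqueNumber≤ G ω) where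

      -- Group the colourings by the result of switching. Each group is indexed by the independent
      -- sets of one graph, so `ind-average` applies to it, and its only member with no flexible
      -- vertex is the switched colouring itself. The sum of `𝟙 (switched? c)` therefore counts the
      -- groups.
      #col-switched : ∀ m → m * #col U? ≤ m * threshold ω m * ∑[ c ∈ assignments ] 𝟙 (switched? c) +
                                          ∑[ c ∈ assignments ] (𝟙 (col? U? c) * size (flexible c))
      #col-switched m = begin
        m * #col U?
          ≡⟨ cong (m *_) (trans (∑-cong assignments (λ c → sym (*-identityʳ _))) (∑-switch (λ _ → 1))) ⟩
        m * ∑[ c ∈ assignments ] (𝟙 (switched? c) * ∑[ S ∈ subsets n ] (𝟙 (ind? (switchable? c) S) * 1))
          ≡⟨ cong (m *_) (∑-cong assignments (λ c → cong (𝟙 (switched? c) *_) (∑-cong (subsets n) (λ S → *-identityʳ _)))) ⟩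
        m * ∑[ c ∈ assignments ] (𝟙 (switched? c) * #ind (switchable? c))
          ≡⟨ sym (∑-*ˡ assignments m _) ⟩
        ∑[ c ∈ assignments ] (m * (𝟙 (switched? c) * #ind (switchable? c)))
          ≤⟨ ∑-mono assignments (λ c → begin
               m * (𝟙 (switched? c) * #ind (switchable? c))
                 ≡⟨ rotate m (𝟙 (switched? c)) (#ind (switchable? c)) ⟩
               𝟙 (switched? c) * (m * #ind (switchable? c))
                 ≤⟨ *-monoʳ-≤ (𝟙 (switched? c)) (ind-average ω-bound m (switchable? c)) ⟩
               𝟙 (switched? c) * (m * threshold ω m + total c)
                 ≡⟨ distribute (𝟙 (switched? c)) (m * threshold ω m) (total c) ⟩
               m * threshold ω m * 𝟙 (switched? c) + 𝟙 (switched? c) * total c ∎) ⟩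
        ∑[ c ∈ assignments ] (m * threshold ω m * 𝟙 (switched? c) + 𝟙 (switched? c) * total c)
          ≡⟨ ∑-+ assignments _ _ ⟩
        ∑[ c ∈ assignments ] (m * threshold ω m * 𝟙 (switched? c)) + ∑[ c ∈ assignments ] (𝟙 (switched? c) * total c)
          ≡⟨ cong₂ _+_ (∑-*ˡ assignments (m * threshold ω m) _) (sym (∑-switch id)) ⟩
        m * threshold ω m * ∑[ c ∈ assignments ] 𝟙 (switched? c) +
          ∑[ c ∈ assignments ] (𝟙 (col? U? c) * size (flexible c)) ∎
        where
        open ≤-Reasoning
        total : Vec ℕ n → ℕ
        total c = ∑[ S ∈ subsets n ] (𝟙 (ind? (switchable? c) S) * size S)
        rotate : ∀ a b c → a * (b * c) ≡ b * (a * c)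
        rotate = solve-∀
        distribute : ∀ a b c → a * (b + c) ≡ b * a + a * c
        distribute = solve-∀

  -- Colours seen around a vertex

  blocked : ∀ c v x → ¬ Free c v x → ∃ λ w → v ~ w × lookup c w ≡ x
  blocked c v x ¬free with ¬∀⟶∃¬ n _ (λ w → (v ~? w) →-dec ¬? (lookup c w ≟ x)) ¬free
  ... | w , h with v ~? w | lookup c w ≟ x
  ...   | yes v~w | yes cw≡x = w , v~w , cw≡x
  ...   | yes v~w | no cw≢x  = contradiction (λ _ → cw≢x) h
  ...   | no v≁w  | _        = contradiction (λ v~w → contradiction v~w v≁w) h

  -- Each vertex uses at most one colour of a list.
  ∑-colours≤card : ∀ c v {Y : ℕ → Fin n → Set} {X : Fin n → Set} (Y? : ∀ x u → Dec (Y x u)) (X? : ∀ u → Dec (X u)) →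
                   (∀ x u → Y x u → X u × lookup c u ≡ x) →
                   ∑[ x ∈ L v ] card (Y? x) ≤ card X?
  ∑-colours≤card c v Y? X? h = begin
    ∑[ x ∈ L v ] card (Y? x)
      ≡⟨ ∑-swap (L v) (allFin n) _ ⟩
    ∑[ u ∈ allFin n ] ∑[ x ∈ L v ] 𝟙 (Y? x u)
      ≤⟨ ∑-mono (allFin n) (λ u → ∑-mono (L v) (λ x → ≤-trans
           (𝟙-mono (Y? x u) (X? u ×-dec (x ≟ lookup c u)) (λ y → let a , b = h x u y in a , sym b))
           (≤-reflexive (𝟙-× (X? u) (x ≟ lookup c u))))) ⟩
    ∑[ u ∈ allFin n ] ∑[ x ∈ L v ] (𝟙 (X? u) * 𝟙 (x ≟ lookup c u))
      ≤⟨ ∑-mono (allFin n) (λ u → ≤-trans (≤-reflexive (∑-*ˡ (L v) (𝟙 (X? u)) _))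
           (≤-trans (*-monoʳ-≤ (𝟙 (X? u)) (mult≤1 (L-unique v))) (≤-reflexive (*-identityʳ _)))) ⟩
    card X? ∎
    where open ≤-Reasoning

  -- Growth of the number of colourings when a vertex is added

  module _ {Δ : ℕ} (Δ-bound : MaxDegree≤ G Δ) where

    card-neighbours : ∀ v → card (v ~?_) ≤ Δ
    card-neighbours v = subst (_≤ Δ) (length-filter-∑ (v ~?_) (allFin n)) (Δ-bound v)

    -- Covers small Δ, where no positive m is available and lists of Δ + 1 colours are short enough.
    greedy-step : ∀ {U : Fin n → Set} (U? : ∀ u → Dec (U u)) v → U v → Δ < length (L v) → #col (U? ∖? v) ≤ #col U?
    greedy-step U? v v∈U Δ<L = begin
      #col (U? ∖? v)
        ≤⟨ ∑-mono assignments (λ c → ≤-trans (≤-reflexive (sym (*-identityʳ _)))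
             (*-monoʳ-≤ (𝟙 (col? (U? ∖? v) c)) (some-free c))) ⟩
      ∑[ c ∈ assignments ] (𝟙 (col? (U? ∖? v) c) * #free c v)
        ≡⟨ sym (#col-free U? v v∈U) ⟩
      #col U? ∎
      where
      open ≤-Reasoning
      some-free : ∀ c → 1 ≤ #free c v
      some-free c = +-cancelʳ-≤ Δ _ _ (begin
        suc Δ
          ≤⟨ Δ<L ⟩
        length (L v)
          ≡⟨ sym (*-identityʳ _) ⟩
        length (L v) * 1
          ≡⟨ sym (∑-const (L v) 1) ⟩
        ∑[ x ∈ L v ] 1
          ≤⟨ ∑-mono (L v) covered ⟩
        ∑[ x ∈ L v ] (𝟙 (free? c v x) + card (uses? x))
          ≡⟨ ∑-+ (L v) _ _ ⟩
        #free c v + ∑[ x ∈ L v ] card (uses? x)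
          ≤⟨ +-monoʳ-≤ _ (≤-trans (∑-colours≤card c v uses? (v ~?_) (λ x u h → h)) (card-neighbours v)) ⟩
        #free c v + Δ ∎)
        where
        uses? : ∀ x u → Dec (v ~ u × lookup c u ≡ x)
        uses? x u = (v ~? u) ×-dec (lookup c u ≟ x)
        covered : ∀ x → 1 ≤ 𝟙 (free? c v x) + card (uses? x)
        covered x = 1≤𝟙+ (free? c v x) (λ ¬free →
          let w , v~w , cw≡x = blocked c v x ¬free
          in ≤-trans (≤-reflexive (sym (𝟙-yes (uses? x w) (v~w , cw≡x))))
                     (∑-∈ (allFin n) (λ u → 𝟙 (uses? x u)) (∈-allFin w)))

    module _ {ω : ℕ} .{{_ : NonZero ω}} (ω-bound : CliqueNumber≤ G ω)
             (k m : ℕ) .{{_ : NonZero m}} (L-length : ∀ u → length (L u) ≡ k)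
             (2Δ≤mk : 2 * Δ ≤ m * k) (8θ²m≤k : 8 * (threshold ω m * threshold ω m * m) ≤ k) where

      -- This factor reproduces itself: as a hypothesis it limits the term m θ T₁ of `main` to half
      -- of Δ Z (`tight-rare`), and 8 θ² m ≤ k turns the resulting k Z ≤ 4 θ Y into the same factor
      -- for U.
      θ ratio : ℕ
      θ     = threshold ω m
      ratio = 2 * (θ * m)

      private
        θ≢0 : NonZero θ
        θ≢0 = m*n≢0 2 _ {{_}} {{m^n≢0 _ (2 * m) {{m*n≢0 _ _ {{b≢0}} {{b≢0}}}}}}
          where
          b≢0 : NonZero ((4 * ω) ^ suc (6 * m))
          b≢0 = m^n≢0 (4 * ω) (suc (6 * m)) {{m*n≢0 4 ω}}

      Expanding : {U : Fin n → Set} → (∀ u → Dec (U u)) → Set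
      Expanding {U} U? = ∀ v → U v → ratio * #col (U? ∖? v) ≤ #col U?

      module _ {U : Fin n → Set} (U? : ∀ u → Dec (U u)) (v : Fin n) (v∈U : U v) (IH : Expanding (U? ∖? v)) where

        private
          W? : ∀ u → Dec (U u × u ≢ v)
          W? = U? ∖? v

          X? : ∀ u → Dec ((U u × u ≢ v) × v ~ u)
          X? = W? ∩N? v

          X≤Δ : card X? ≤ Δ
          X≤Δ = ≤-trans (card-mono X? (v ~?_) (λ _ → proj₂)) (card-neighbours v)

          open module Sw x = Switching W? X? (λ _ → proj₁) x

          tight? : ∀ c u → Dec (((U u × u ≢ v) × v ~ u) × #free c u ≤ 1)
          tight? c u = X? u ×-dec (#free c u ≤? 1)

          Z Y T₁ : ℕ
          Z  = #col W?
          Y  = #col U?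
          T₁ = ∑[ c ∈ assignments ] (𝟙 (col? W? c) * card (tight? c))

          -- A colour of L v that no flexible neighbour uses is free at v or used by a tight neighbour.
          switched≤free+tight : ∀ c → ∑[ x ∈ L v ] 𝟙 (switched? x c) ≤ 𝟙 (col? W? c) * (#free c v + card (tight? c))
          switched≤free+tight c = begin
            ∑[ x ∈ L v ] 𝟙 (switched? x c)
              ≤⟨ ∑-mono-∈ (L v) pointwise ⟩
            ∑[ x ∈ L v ] (𝟙 (col? W? c) * (𝟙 (free? c v x) + card (uses? x)))
              ≡⟨ trans (∑-*ˡ (L v) (𝟙 (col? W? c)) _) (cong (𝟙 (col? W? c) *_) (∑-+ (L v) _ _)) ⟩
            𝟙 (col? W? c) * (#free c v + ∑[ x ∈ L v ] card (uses? x))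
              ≤⟨ *-monoʳ-≤ (𝟙 (col? W? c)) (+-monoʳ-≤ (#free c v) (∑-colours≤card c v uses? (tight? c) (λ x u h → h))) ⟩
            𝟙 (col? W? c) * (#free c v + card (tight? c)) ∎
            where
            open ≤-Reasoning
            uses? : ∀ x u → Dec ((((U u × u ≢ v) × v ~ u) × #free c u ≤ 1) × lookup c u ≡ x)
            uses? x u = tight? c u ×-dec (lookup c u ≟ x)
            covered : ∀ x → x ∈ L v → Switched x c → 1 ≤ 𝟙 (free? c v x) + card (uses? x)
            covered x x∈ (col , rigid) = 1≤𝟙+ (free? c v x) (λ ¬free →
              let w , v~w , cw≡x = blocked c v x ¬free
                  -- The vertex w is coloured: its colour x belongs to `L v`, so it is not the
                  -- marker 0.
                  w∈W = decidable-stable (W? w) (λ w∉W →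
                    L-positive v (subst (_∈ L v) (trans (sym cw≡x) (proj₂ (col w) w∉W)) x∈))
                  w-tight = ≤-pred (≰⇒> (λ h → rigid w ((w∈W , v~w) , cw≡x , h)))
              in ≤-trans (≤-reflexive (sym (𝟙-yes (uses? x w) (((w∈W , v~w) , w-tight) , cw≡x))))
                         (∑-∈ (allFin n) (λ u → 𝟙 (uses? x u)) (∈-allFin w)))
            pointwise : ∀ x → x ∈ L v → 𝟙 (switched? x c) ≤ 𝟙 (col? W? c) * (𝟙 (free? c v x) + card (uses? x))
            pointwise x x∈ = begin
              𝟙 (switched? x c)
                ≡⟨ trans (sym (*-identityʳ _)) (trans
                     (𝟙-*-cong (switched? x c) (λ s → sym (𝟙-yes (col? W? c) (proj₁ s))))
                     (*-comm (𝟙 (switched? x c)) _)) ⟩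
              𝟙 (col? W? c) * 𝟙 (switched? x c)
                ≤⟨ *-monoʳ-≤ (𝟙 (col? W? c)) (𝟙≤ (switched? x c) (covered x x∈)) ⟩
              𝟙 (col? W? c) * (𝟙 (free? c v x) + card (uses? x)) ∎

          -- The sum of `#col-switched` over the k colours of `L v`. In a fixed colouring, the
          -- flexible sets for different x are disjoint sets of neighbours of v, so their sizes add
          -- up to at most Δ.
          main : m * k * Z ≤ m * θ * (Y + T₁) + Δ * Z
          main = begin
            m * k * Z
              ≡⟨ trans (rotate m k Z) (trans (cong (_* (m * Z)) (sym (L-length v))) (sym (∑-const (L v) (m * Z)))) ⟩
            ∑[ x ∈ L v ] (m * Z)
              ≤⟨ ∑-mono (L v) (λ x → #col-switched x ω-bound m) ⟩
            ∑[ x ∈ L v ] (m * θ * ∑[ c ∈ assignments ] 𝟙 (switched? x c) +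
                          ∑[ c ∈ assignments ] (𝟙 (col? W? c) * size (flexible x c)))
              ≡⟨ ∑-+ (L v) _ _ ⟩
            ∑[ x ∈ L v ] (m * θ * ∑[ c ∈ assignments ] 𝟙 (switched? x c)) +
            ∑[ x ∈ L v ] ∑[ c ∈ assignments ] (𝟙 (col? W? c) * size (flexible x c))
              ≤⟨ +-mono-≤ part₁ part₂ ⟩
            m * θ * (Y + T₁) + Δ * Z ∎
            where
            open ≤-Reasoning
            rotate : ∀ m k Z → m * k * Z ≡ k * (m * Z)
            rotate = solve-∀
            part₁ : ∑[ x ∈ L v ] (m * θ * ∑[ c ∈ assignments ] 𝟙 (switched? x c)) ≤ m * θ * (Y + T₁)
            part₁ = begin
              ∑[ x ∈ L v ] (m * θ * ∑[ c ∈ assignments ] 𝟙 (switched? x c))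
                ≡⟨ trans (∑-*ˡ (L v) (m * θ) _) (cong (m * θ *_) (∑-swap (L v) assignments _)) ⟩
              m * θ * ∑[ c ∈ assignments ] ∑[ x ∈ L v ] 𝟙 (switched? x c)
                ≤⟨ *-monoʳ-≤ (m * θ) (∑-mono assignments switched≤free+tight) ⟩
              m * θ * ∑[ c ∈ assignments ] (𝟙 (col? W? c) * (#free c v + card (tight? c)))
                ≡⟨ cong (m * θ *_) (trans (∑-cong assignments (λ c → *-distribˡ-+ (𝟙 (col? W? c)) (#free c v) (card (tight? c))))
                     (trans (∑-+ assignments _ _) (cong (_+ T₁) (sym (#col-free U? v v∈U))))) ⟩
              m * θ * (Y + T₁) ∎
            part₂ : ∑[ x ∈ L v ] ∑[ c ∈ assignments ] (𝟙 (col? W? c) * size (flexible x c)) ≤ Δ * Z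
            part₂ = begin
              ∑[ x ∈ L v ] ∑[ c ∈ assignments ] (𝟙 (col? W? c) * size (flexible x c))
                ≡⟨ trans (∑-swap (L v) assignments _) (∑-cong assignments (λ c → ∑-*ˡ (L v) (𝟙 (col? W? c)) _)) ⟩
              ∑[ c ∈ assignments ] (𝟙 (col? W? c) * ∑[ x ∈ L v ] size (flexible x c))
                ≤⟨ ∑-mono assignments (λ c → *-monoʳ-≤ (𝟙 (col? W? c)) (≤-trans
                     (∑-colours≤card c v (λ x u → T? (lookup (flexible x c) u)) X?
                       (λ x u h → let a , b , _ = ∈-flexible⁻ x c u h in a , b)) X≤Δ)) ⟩
              ∑[ c ∈ assignments ] (𝟙 (col? W? c) * Δ)
                ≡⟨ trans (∑-*ʳ assignments Δ _) (*-comm Z Δ) ⟩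
              Δ * Z ∎

          -- By `#col-tight` and the induction hypothesis, a given neighbour u is tight in at most Z
          -- / `ratio` colourings. There are at most Δ neighbours.
          tight-rare : ratio * T₁ ≤ Δ * Z
          tight-rare = begin
            ratio * T₁
              ≡⟨ cong (ratio *_) (trans (∑-cong assignments (λ c → trans
                   (sym (∑-*ˡ (allFin n) (𝟙 (col? W? c)) _))
                   (∑-cong (allFin n) (λ u → trans (cong (𝟙 (col? W? c) *_) (𝟙-× (X? u) (#free c u ≤? 1)))
                     (rotate (𝟙 (col? W? c)) (𝟙 (X? u)) (𝟙 (#free c u ≤? 1)))))))
                 (trans (∑-swap assignments (allFin n) _) (∑-cong (allFin n) (λ u → ∑-*ˡ assignments (𝟙 (X? u)) _)))) ⟩
            ratio * ∑[ u ∈ allFin n ] (𝟙 (X? u) * ∑[ c ∈ assignments ] (𝟙 (col? W? c) * 𝟙 (#free c u ≤? 1)))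
              ≡⟨ sym (∑-*ˡ (allFin n) ratio _) ⟩
            ∑[ u ∈ allFin n ] (ratio * (𝟙 (X? u) * ∑[ c ∈ assignments ] (𝟙 (col? W? c) * 𝟙 (#free c u ≤? 1))))
              ≤⟨ ∑-mono (allFin n) (λ u → ≤-trans
                   (≤-reflexive (rotate ratio (𝟙 (X? u)) _))
                   (𝟙-*-mono (X? u) (λ { (u∈W , _) → ≤-trans (*-monoʳ-≤ ratio (#col-tight W? u u∈W)) (IH u u∈W) }))) ⟩
            ∑[ u ∈ allFin n ] (𝟙 (X? u) * Z)
              ≡⟨ ∑-*ʳ (allFin n) Z _ ⟩
            card X? * Z
              ≤⟨ *-monoˡ-≤ Z X≤Δ ⟩
            Δ * Z ∎
            where
            open ≤-Reasoning
            rotate : ∀ a b c → a * (b * c) ≡ b * (a * c)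
            rotate = solve-∀

        expanding-step : ratio * #col (U? ∖? v) ≤ #col U?
        expanding-step = *-cancelˡ-≤ (4 * θ) {{m*n≢0 4 θ {{_}} {{θ≢0}}}} (begin
          4 * θ * (ratio * Z)         ≡⟨ e₁ θ m Z ⟩
          8 * (θ * θ * m) * Z         ≤⟨ *-monoˡ-≤ Z 8θ²m≤k ⟩
          k * Z                       ≤⟨ kZ≤ ⟩
          4 * θ * Y                   ∎)
          where
          open ≤-Reasoning
          e₁ : ∀ θ m Z → 4 * θ * (2 * (θ * m) * Z) ≡ 8 * (θ * θ * m) * Z
          e₁ = solve-∀
          e₂ : ∀ m k Z → 3 * (m * k * Z) + m * (k * Z) ≡ 4 * (m * k * Z)
          e₂ = solve-∀
          e₃ : ∀ m θ Y T₁ ΔZ → 4 * (m * θ * (Y + T₁) + ΔZ) ≡ m * (4 * θ * Y) + 2 * (2 * (θ * m) * T₁) + 4 * ΔZ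
          e₃ = solve-∀
          e₄ : ∀ a ΔZ → a + 2 * ΔZ + 4 * ΔZ ≡ 3 * (2 * ΔZ) + a
          e₄ = solve-∀
          kZ≤ : k * Z ≤ 4 * θ * Y
          -- Of 4 m k Z, tight neighbours account for at most 2 Δ Z and flexible ones for 4 Δ Z.
          -- Together this is at most 3 m k Z, which leaves a quarter for the free colours at v.
          kZ≤ = *-cancelˡ-≤ m (+-cancelˡ-≤ (3 * (m * k * Z)) _ _ (begin
            3 * (m * k * Z) + m * (k * Z)
              ≡⟨ e₂ m k Z ⟩
            4 * (m * k * Z)
              ≤⟨ *-monoʳ-≤ 4 main ⟩
            4 * (m * θ * (Y + T₁) + Δ * Z)
              ≡⟨ e₃ m θ Y T₁ (Δ * Z) ⟩
            m * (4 * θ * Y) + 2 * (ratio * T₁) + 4 * (Δ * Z)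
              ≤⟨ +-monoˡ-≤ (4 * (Δ * Z)) (+-monoʳ-≤ (m * (4 * θ * Y)) (*-monoʳ-≤ 2 tight-rare)) ⟩
            m * (4 * θ * Y) + 2 * (Δ * Z) + 4 * (Δ * Z)
              ≡⟨ e₄ (m * (4 * θ * Y)) (Δ * Z) ⟩
            3 * (2 * (Δ * Z)) + m * (4 * θ * Y)
              ≤⟨ +-monoˡ-≤ (m * (4 * θ * Y)) (*-monoʳ-≤ 3 (begin
                   2 * (Δ * Z)   ≡⟨ sym (*-assoc 2 Δ Z) ⟩
                   2 * Δ * Z     ≤⟨ *-monoˡ-≤ Z 2Δ≤mk ⟩
                   m * k * Z     ∎)) ⟩
            3 * (m * k * Z) + m * (4 * θ * Y) ∎))

      -- The recursion runs on a bound N for the number of vertices, because the step needs the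
      -- claim for U ∖ {v} at all of its vertices.
      expanding : ∀ N {U : Fin n → Set} (U? : ∀ u → Dec (U u)) → card U? ≤ N → Expanding U?
      expanding zero    U? h v v∈U = contradiction (≤-trans (card-∖-< U? v∈U) h) λ ()
      expanding (suc N) U? h v v∈U =
        expanding-step U? v v∈U (expanding N (U? ∖? v) (≤-pred (≤-trans (card-∖-< U? v∈U) h)))

      counting-step : ∀ {U : Fin n → Set} (U? : ∀ u → Dec (U u)) v → U v → #col (U? ∖? v) ≤ #col U?
      counting-step U? v v∈U = ≤-trans (m≤n*m _ ratio {{m*n≢0 2 (θ * m) {{_}} {{m*n≢0 θ m {{θ≢0}}}}}})
                                       (expanding _ U? ≤-refl v v∈U)

  -- From growth to the existence of a list colouring

  module _ (step : ∀ {U : Fin n → Set} (U? : ∀ u → Dec (U u)) v → U v → #col (U? ∖? v) ≤ #col U?) where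

    #col-positive : ∀ N {U : Fin n → Set} (U? : ∀ u → Dec (U u)) → card U? ≤ N → 1 ≤ #col U?
    #col-positive N {U} U? h with any? U?
    #col-positive zero    U? h | yes (v , v∈U) = contradiction (≤-trans (card-∖-< U? v∈U) h) λ ()
    #col-positive (suc N) U? h | yes (v , v∈U) =
      ≤-trans (#col-positive N (U? ∖? v) (≤-pred (≤-trans (card-∖-< U? v∈U) h))) (step U? v v∈U)
    #col-positive N {U} U? h | no empty = begin
      1
        ≡⟨ sym (mult-col U? blank blank-col) ⟩
      Multiplicity.mult _≟ᶜ_ blank assignments
        ≤⟨ ∑-mono assignments (λ c → 𝟙-mono (c ≟ᶜ blank) (col? U? c) (λ { refl → blank-col })) ⟩
      #col U? ∎
      where
      open ≤-Reasoning
      blank : Vec ℕ n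
      blank = Vec.replicate n 0
      blank-col : Col U blank
      blank-col u = (λ u∈U → contradiction (u , u∈U) empty) , λ _ → lookup-replicate u 0

    colouring : ∃ λ c → ∀ u → lookup c u ∈ L u × Free c u (lookup c u)
    colouring = let c , col = ∑-positive assignments (col? everything?) (#col-positive _ everything? ≤-refl)
                in c , λ u → proj₁ (col u) _
      where
      everything? : Fin n → Dec ⊤
      everything? _ = yes _

-- Lists are cut to exactly k colours, since the counting uses their length as an equality, and
-- shifted by one so that 0 is free to mark uncoloured vertices. `pred` undoes the shift.
choosable : ∀ {n} (G : Graph n) k →
  (∀ L (L-unique : ∀ u → Unique (L u)) (L-positive : ∀ u → 0 ∉ L u) → (∀ u → length (L u) ≡ k) →
   let open Colouring G L L-unique L-positive in ∃ λ c → ∀ u → lookup c u ∈ L u × Free c u (lookup c u)) →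
  Choosable G k
choosable {n} G k colour (L , L-valid) = (λ u → pred (lookup c u)) , in-list , proper
  where
  L′ : Fin n → List ℕ
  L′ u = map suc (take k (L u))
  0∉L′ : ∀ u → 0 ∉ L′ u
  0∉L′ u i with ∈-map⁻ suc i
  ... | _ , _ , ()
  L′-length : ∀ u → length (L′ u) ≡ k
  L′-length u = trans (length-map suc (take k (L u))) (trans (length-take k (L u)) (m≤n⇒m⊓n≡m (proj₂ (L-valid u))))
  coloured : _
  coloured = colour L′ (λ u → map⁺ suc-injective (take⁺ k (proj₁ (L-valid u)))) 0∉L′ L′-length
  c : Vec ℕ n
  c = proj₁ coloured
  in-list : ∀ u → pred (lookup c u) ∈ L u
  in-list u with ∈-map⁻ suc (proj₁ (proj₂ coloured u))
  ... | a , i , e = subst (_∈ L u) (sym (cong pred e)) (subst (a ∈_) (take++drop≡id k (L u)) (∈-++⁺ˡ i))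
  suc-pred-colour : ∀ u → suc (pred (lookup c u)) ≡ lookup c u
  suc-pred-colour u with ∈-map⁻ suc (proj₁ (proj₂ coloured u))
  ... | a , i , e = trans (cong (λ (b : ℕ) → suc (pred b)) e) (sym e)
  proper : ∀ u v → T (adj G u v) → pred (lookup c u) ≢ pred (lookup c v)
  proper u v u~v e = proj₂ (proj₂ coloured u) v u~v
    (trans (sym (suc-pred-colour v)) (trans (cong suc (sym e)) (suc-pred-colour u)))

-- Choice of parameters

n<m^n : ∀ {m} → 2 ≤ m → ∀ n → n < m ^ n
n<m^n 2≤m zero = s≤s z≤n
n<m^n {m} 2≤m (suc n) = begin
  1 + suc n        ≤⟨ +-mono-≤ (m^n>0 m {{>-nonZero (≤-trans (s≤s z≤n) 2≤m)}} n) (n<m^n 2≤m n) ⟩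
  m ^ n + m ^ n    ≡⟨ cong (m ^ n +_) (sym (+-identityʳ _)) ⟩
  2 * m ^ n        ≤⟨ *-monoˡ-≤ (m ^ n) 2≤m ⟩
  m ^ suc n        ∎
  where open ≤-Reasoning

greatest : {P : ℕ → Set} → (∀ m → Dec (P m)) → P 0 → ∀ N → ¬ P N → ∃ λ m → P m × ¬ P (suc m)
greatest P? p₀ zero    ¬p = contradiction p₀ ¬p
greatest P? p₀ (suc N) ¬p with P? N
... | yes p = N , p , ¬p
... | no ¬q = greatest P? p₀ N ¬q

exponent-bound : ∀ m .{{_ : NonZero m}} → 2 + 8 * m + 8 * m * (6 * m) + 2 * m ≤ 60 * (m * m)
-- For m = r + 1 the two sides differ by exactly 12 r² + 14 r.
exponent-bound m@(suc r) = ≤-trans (m≤m+n _ (12 * (r * r) + 14 * r)) (≤-reflexive (e r))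
  where
  e : ∀ r → 2 + 8 * suc r + 8 * suc r * (6 * suc r) + 2 * suc r + (12 * (r * r) + 14 * r) ≡ 60 * (suc r * suc r)
  e = solve-∀

-- With β = 4ω the threshold is 2 β^p, where 2p = 48 m² + 8 m. The left side is 16 m² β^(2p), which
-- is at most β^(2 + 2m + 2p) ≤ β^(60 m²), and β ≤ ω³ gives 180 = 3 · 60.
threshold-bound : ∀ {ω} → 2 ≤ ω → ∀ m .{{_ : NonZero m}} →
                  4 * (threshold ω m * threshold ω m * (m * m)) ≤ ω ^ (180 * (m * m))
threshold-bound {ω} 2≤ω m = begin
  4 * (threshold ω m * threshold ω m * (m * m))
    ≡⟨ cong (λ q → 4 * (2 * q * (2 * q) * (m * m))) power ⟩
  4 * (2 * β ^ p * (2 * β ^ p) * (m * m))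
    ≡⟨ regroup (β ^ p) m ⟩
  4 ^ 2 * (m * m) * (β ^ p * β ^ p)
    ≤⟨ *-monoˡ-≤ (β ^ p * β ^ p) (*-mono-≤ (^-monoˡ-≤ 2 4≤β) (*-mono-≤ m≤β^m m≤β^m)) ⟩
  β ^ 2 * (β ^ m * β ^ m) * (β ^ p * β ^ p)
    ≡⟨ sym (trans (^-distribˡ-+-* β (2 + (m + m)) (p + p)) (cong₂ _*_
         (trans (^-distribˡ-+-* β 2 (m + m)) (cong (β ^ 2 *_) (^-distribˡ-+-* β m m))) (^-distribˡ-+-* β p p))) ⟩
  β ^ (2 + (m + m) + (p + p))
    ≤⟨ ^-monoʳ-≤ β (≤-trans (≤-reflexive (exponent m)) (exponent-bound m)) ⟩
  β ^ (60 * (m * m))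
    ≤⟨ ^-monoˡ-≤ (60 * (m * m)) β≤ω³ ⟩
  (ω ^ 3) ^ (60 * (m * m))
    ≡⟨ trans (^-*-assoc ω 3 (60 * (m * m))) (cong (ω ^_) (sym (*-assoc 3 60 (m * m)))) ⟩
  ω ^ (180 * (m * m)) ∎
  where
  open ≤-Reasoning
  β p : ℕ
  β = 4 * ω
  p = (suc (6 * m) + suc (6 * m)) * (2 * m)
  instance
    ω≢0 : NonZero ω
    ω≢0 = >-nonZero (≤-trans (s≤s z≤n) 2≤ω)
    β≢0 : NonZero β
    β≢0 = m*n≢0 4 ω
  4≤β : 4 ≤ β
  4≤β = m≤m*n 4 ω
  m≤β^m : m ≤ β ^ m
  m≤β^m = <⇒≤ (n<m^n (≤-trans (s≤s (s≤s z≤n)) 4≤β) m)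
  β≤ω³ : β ≤ ω ^ 3
  β≤ω³ = ≤-trans (*-monoˡ-≤ ω (*-mono-≤ 2≤ω 2≤ω)) (≤-reflexive (cube ω))
    where
    cube : ∀ ω → ω * ω * ω ≡ ω * (ω * (ω * 1))
    cube = solve-∀
  power : (β ^ suc (6 * m) * β ^ suc (6 * m)) ^ (2 * m) ≡ β ^ p
  power = trans (cong (_^ (2 * m)) (sym (^-distribˡ-+-* β (suc (6 * m)) (suc (6 * m)))))
                (^-*-assoc β (suc (6 * m) + suc (6 * m)) (2 * m))
  regroup : ∀ q m → 4 * (2 * q * (2 * q) * (m * m)) ≡ 4 ^ 2 * (m * m) * (q * q)
  regroup q m = e q m
    where
    e : ∀ q m → 4 * (2 * q * (2 * q) * (m * m)) ≡ 16 * (m * m) * (q * q)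
    e = solve-∀
  exponent : ∀ m → let p = (suc (6 * m) + suc (6 * m)) * (2 * m) in
             2 + (m + m) + (p + p) ≡ 2 + 8 * m + 8 * m * (6 * m) + 2 * m
  exponent = solve-∀

-- The exponent 180 comes from threshold-bound; m is about √(ln Δ / ln ω).
theorem1p6 : Σ ℕ λ D → D > 0 × ((Δ ω : ℕ) → Δ ≥ 2 → ω ≥ 2 → (n : ℕ) → (G : Graph n) →
    MaxDegree≤ G Δ → CliqueNumber≤ G ω →
    Σ ℕ λ k → Choosable G k × Δ ^ (k * k) ≤ ω ^ (D * (Δ * Δ)))
-- Taking logarithms, Δ^(k²) ≤ ω^(DΔ²) says k ≤ √D · Δ √(ln ω / ln Δ), so C = √D. The 36 is (2 ·
-- 3)²: a factor 2 because the upper bound on Δ involves m + 1 instead of m, and a factor 3 from m k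
-- ≤ 3 Δ.
theorem1p6 = 36 * 180 , s≤s z≤n , bound
  where
  open ≤-Reasoning
  bound : (Δ ω : ℕ) → Δ ≥ 2 → ω ≥ 2 → (n : ℕ) → (G : Graph n) →
    MaxDegree≤ G Δ → CliqueNumber≤ G ω →
    Σ ℕ λ k → Choosable G k × Δ ^ (k * k) ≤ ω ^ (36 * 180 * (Δ * Δ))
  bound Δ ω 2≤Δ 2≤ω n G Δ-bound ω-bound
    with greatest (λ m → ω ^ (180 * (m * m)) ≤? Δ) (≤-trans (s≤s z≤n) 2≤Δ) Δ
           (<⇒≱ (<-≤-trans (n<m^n 2≤ω Δ) (^-monoʳ-≤ ω {{>-nonZero (≤-trans (s≤s z≤n) 2≤ω)}}
             (≤-trans (m≤m*n Δ Δ {{>-nonZero (≤-trans (s≤s z≤n) 2≤Δ)}}) (m≤n*m (Δ * Δ) 180)))))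
  ... | m , low , high = m-cases m low (≰⇒> high)
    where
    instance
      ω≢0 : NonZero ω
      ω≢0 = >-nonZero (≤-trans (s≤s z≤n) 2≤ω)
    estimate : ∀ a k → Δ < ω ^ (180 * a) → a * (k * k) ≤ 36 * (Δ * Δ) → Δ ^ (k * k) ≤ ω ^ (36 * 180 * (Δ * Δ))
    estimate a k Δ< h = begin
      Δ ^ (k * k)                    ≤⟨ ^-monoˡ-≤ (k * k) (<⇒≤ Δ<) ⟩
      (ω ^ (180 * a)) ^ (k * k)      ≡⟨ ^-*-assoc ω (180 * a) (k * k) ⟩
      ω ^ (180 * a * (k * k))        ≤⟨ ^-monoʳ-≤ ω (begin
        180 * a * (k * k)              ≡⟨ *-assoc 180 a (k * k) ⟩
        180 * (a * (k * k))            ≤⟨ *-monoʳ-≤ 180 h ⟩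
        180 * (36 * (Δ * Δ))           ≡⟨ sym (*-assoc 180 36 (Δ * Δ)) ⟩
        36 * 180 * (Δ * Δ)             ∎) ⟩
      ω ^ (36 * 180 * (Δ * Δ))       ∎
    m-cases : ∀ m → ω ^ (180 * (m * m)) ≤ Δ → Δ < ω ^ (180 * (suc m * suc m)) →
              Σ ℕ λ k → Choosable G k × Δ ^ (k * k) ≤ ω ^ (36 * 180 * (Δ * Δ))
    -- Here Δ < ω^180, so Δ + 1 colours already meet the bound.
    m-cases zero low high = suc Δ ,
      choosable G (suc Δ) (λ L L-unique L-positive L-length →
        let open Colouring G L L-unique L-positive in
        colouring (λ U? v v∈U → greedy-step Δ-bound U? v v∈U (≤-reflexive (sym (L-length v))))) ,
      estimate 1 (suc Δ) high (begin
        1 * (suc Δ * suc Δ)       ≡⟨ *-identityˡ _ ⟩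
        suc Δ * suc Δ             ≤⟨ *-mono-≤ 1+Δ≤2Δ 1+Δ≤2Δ ⟩
        (Δ + Δ) * (Δ + Δ)         ≤⟨ m≤m+n _ (32 * (Δ * Δ)) ⟩
        (Δ + Δ) * (Δ + Δ) + 32 * (Δ * Δ) ≡⟨ e Δ ⟩
        36 * (Δ * Δ)              ∎)
      where
      1+Δ≤2Δ : suc Δ ≤ Δ + Δ
      1+Δ≤2Δ = +-monoˡ-≤ Δ (≤-trans (s≤s z≤n) 2≤Δ)
      e : ∀ Δ → (Δ + Δ) * (Δ + Δ) + 32 * (Δ * Δ) ≡ 36 * (Δ * Δ)
      e = solve-∀
    m-cases m@(suc _) low high = k ,
      choosable G k (λ L L-unique L-positive L-length →
        let open Colouring G L L-unique L-positive in
        colouring (counting-step Δ-bound ω-bound k m L-length 2Δ≤mk 8θ²m≤k)) ,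
      estimate (suc m * suc m) k high (begin
        suc m * suc m * (k * k)                ≤⟨ *-monoˡ-≤ (k * k) (*-mono-≤ 1+m≤2m 1+m≤2m) ⟩
        (m + m) * (m + m) * (k * k)            ≡⟨ e₁ m k ⟩
        4 * (m * k * (m * k))                  ≤⟨ *-monoʳ-≤ 4 (*-mono-≤ mk≤3Δ mk≤3Δ) ⟩
        4 * (3 * Δ * (3 * Δ))                  ≡⟨ e₂ Δ ⟩
        36 * (Δ * Δ)                           ∎)
      where
      θ k : ℕ
      θ = threshold ω m
      -- Rounded up to get 2 Δ ≤ m k; since m ≤ Δ, the excess keeps m k within 3 Δ.
      k = suc (2 * Δ / m)
      1+m≤2m : suc m ≤ m + m
      1+m≤2m = +-monoˡ-≤ m (s≤s z≤n)
      e₁ : ∀ m k → (m + m) * (m + m) * (k * k) ≡ 4 * (m * k * (m * k))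
      e₁ = solve-∀
      e₂ : ∀ Δ → 4 * (3 * Δ * (3 * Δ)) ≡ 36 * (Δ * Δ)
      e₂ = solve-∀
      m≤Δ : m ≤ Δ
      m≤Δ = begin
        m                     ≤⟨ ≤-trans (m≤m*n m m) (m≤n*m (m * m) 180) ⟩
        180 * (m * m)         ≤⟨ <⇒≤ (n<m^n 2≤ω _) ⟩
        ω ^ (180 * (m * m))   ≤⟨ low ⟩
        Δ                     ∎
      2Δ≤mk : 2 * Δ ≤ m * k
      2Δ≤mk = begin
        2 * Δ                              ≡⟨ m≡m%n+[m/n]*n (2 * Δ) m ⟩
        2 * Δ % m + 2 * Δ / m * m          ≤⟨ +-monoˡ-≤ _ (<⇒≤ (m%n<n (2 * Δ) m)) ⟩
        k * m                              ≡⟨ *-comm k m ⟩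
        m * k                              ∎
      mk≤3Δ : m * k ≤ 3 * Δ
      mk≤3Δ = begin
        m * k                 ≡⟨ *-comm m k ⟩
        m + 2 * Δ / m * m     ≤⟨ +-mono-≤ m≤Δ (m/n*n≤m (2 * Δ) m) ⟩
        3 * Δ                 ∎
      8θ²m≤k : 8 * (θ * θ * m) ≤ k
      -- Multiplied by m, the claim compares 8 θ² m² with m k, and 2 Δ lies between them by the
      -- choice of m.
      8θ²m≤k = *-cancelˡ-≤ m (begin
        m * (8 * (θ * θ * m))            ≡⟨ e₃ m (θ * θ) ⟩
        2 * (4 * (θ * θ * (m * m)))      ≤⟨ *-monoʳ-≤ 2 (≤-trans (threshold-bound 2≤ω m) low) ⟩
        2 * Δ                            ≤⟨ 2Δ≤mk ⟩
        m * k                            ∎)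
        where
        e₃ : ∀ m q → m * (8 * (q * m)) ≡ 2 * (4 * (q * (m * m)))
        e₃ = solve-∀
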